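{- Let $G$ be a subcubic graph (a graph of maximum degree at most $3$) on $n$ vertices, with no connected component isomorphic to $K_4$. Then a near-bipartite decomposition of $G$ can be found in $O(n)$ time.
   Context: A near-bipartite decomposition of a graph $G$ is a partition $(A,B)$ of its vertex set such that $A$ is an independent set and $B$ induces a forest (equivalently, a $1$-degenerate graph). $K_4$ denotes the complete graph on $4$ vertices. -}

module Defs where

open import Data.Bool.Base using (if_then_else_)
open import Data.Fin.Base using (Fin; toℕ)
open import Data.Fin.Subset using (Subset; _∈_; _∪_; _∩_; ⊤; ⊥; Nonempty)
open import Data.Fin.Properties using () renaming (_≟_ to _≟ᶠ_)
open import Data.List.Base using (List; []; _∷_; _∷ʳ_; length; filter; map; concat; allFin)
open import Data.List.Membership.Propositional using () renaming (_∈_ to _∈ˡ_)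
open import Data.List.Relation.Unary.Linked using (Linked)
open import Data.List.Relation.Unary.Unique.Propositional using (Unique)
open import Data.List.Scans.Base using (scanl)
open import Data.Nat.Base using (ℕ; zero; suc; _+_; _∸_; _<_; _≤_)
open import Data.Nat.Properties using (_≟_)
open import Data.Product.Base using (Σ; ∃; _×_; proj₁)
open import Data.Vec.Base using (lookup)
open import Function.Bundles using (_↔_; _⇔_; Inverse)
open import Level using (0ℓ)
open import Relation.Binary.Construct.Closure.ReflexiveTransitive using (Star)
open import Relation.Binary.Core using (Rel)
open import Relation.Binary.Definitions using (Decidable; Symmetric; Irreflexive)
open import Relation.Binary.PropositionalEquality using (_≡_; _≢_; refl; ≢-sym)
open import Relation.Nullary.Decidable using (does; ¬?)
open import Relation.Nullary.Negation using (¬_)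

record Graph (V : Set) : Set₁ where
  field
    Adj    : Rel V 0ℓ
    sym    : Symmetric Adj
    irrefl : Irreflexive _≡_ Adj
    adj?   : Decidable Adj

open Graph public using (Adj)

K : ∀ m → Graph (Fin m)
K m = record
  { Adj    = _≢_
  ; sym    = ≢-sym
  ; irrefl = λ i≡j i≢j → i≢j i≡j
  ; adj?   = λ i j → ¬? (i ≟ᶠ j)
  }

-- Membership in a Subset is proof-irrelevant, so ∃ (_∈ S) has exactly one
-- element for each member of S.
_⟦_⟧ : ∀ {n} → Graph (Fin n) → (S : Subset n) → Graph (∃ (_∈ S))
G ⟦ S ⟧ = record
  { Adj    = λ u v → Adj G (proj₁ u) (proj₁ v)
  ; sym    = Graph.sym G
  ; irrefl = λ { refl → Graph.irrefl G refl }
  ; adj?   = λ u v → Graph.adj? G (proj₁ u) (proj₁ v)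
  }

record _≅_ {V W : Set} (G : Graph V) (H : Graph W) : Set where
  field
    bijection : V ↔ W
    preserves : ∀ u v → Adj G u v ⇔ Adj H (Inverse.to bijection u) (Inverse.to bijection v)

degree : ∀ {n} → Graph (Fin n) → Fin n → ℕ
degree {n} G v = length (filter (Graph.adj? G v) (allFin n))

Subcubic : ∀ {n} → Graph (Fin n) → Set
Subcubic G = ∀ v → degree G v ≤ 3

IsComponent : ∀ {n} → Graph (Fin n) → Subset n → Set
IsComponent G C = Nonempty C × (∀ u v → u ∈ C → (v ∈ C ⇔ Star (Adj G) u v))

-- The cycle v, u₁, …, uₖ, v, with k ≥ 2.
IsCycle : {V : Set} → Graph V → V → List V → Set
IsCycle G v us = 2 ≤ length us × Unique (v ∷ us) × Linked (Adj G) (v ∷ us ∷ʳ v)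

IsForest : {V : Set} → Graph V → Set
IsForest G = ∀ v us → ¬ IsCycle G v us

IsIndependent : ∀ {n} → Graph (Fin n) → Subset n → Set
IsIndependent G A = ∀ u v → u ∈ A → v ∈ A → ¬ Adj G u v

record IsNearBipartite {n} (G : Graph (Fin n)) (A B : Subset n) : Set where
  field
    covers      : A ∪ B ≡ ⊤
    disjoint    : A ∩ B ≡ ⊥
    independent : IsIndependent G A
    forest      : IsForest (G ⟦ B ⟧)

-- Structured programs for a unit-cost word RAM whose memory consists of
-- named registers and named arrays.  A program mentions finitely many names.

data Expr : Set where
  lit     : ℕ → Expr
  reg     : ℕ → Expr
  _at_    : ℕ → Expr → Expr
  _⊕_ _⊖_ : Expr → Expr → Expr

data Cmd : Set where
  skip            : Cmd
  _≔_             : ℕ → Expr → Cmd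
  _at_←_          : ℕ → Expr → Expr → Cmd
  _⨾_             : Cmd → Cmd → Cmd
  test_then_else_ : Expr → Cmd → Cmd → Cmd
  while_loop_     : Expr → Cmd → Cmd

infixl 6 _⊕_ _⊖_
infix  7 _at_
infix  5 _≔_ _at_←_
infixr 3 _⨾_
infix  4 test_then_else_ while_loop_

record State : Set where
  constructor ⟨_,_⟩
  field
    regs : ℕ → ℕ
    arrs : ℕ → ℕ → ℕ

open State public

_[_↦_] : {X : Set} → (ℕ → X) → ℕ → X → ℕ → X
(f [ k ↦ x ]) j = if does (j ≟ k) then x else f j

eval : State → Expr → ℕ
eval σ (lit k)  = k
eval σ (reg x)  = regs σ x
eval σ (a at e) = arrs σ a (eval σ e)
eval σ (d ⊕ e)  = eval σ d + eval σ e
eval σ (d ⊖ e)  = eval σ d ∸ eval σ e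

cost : Expr → ℕ
cost (lit k)  = 1
cost (reg x)  = 1
cost (a at e) = suc (cost e)
cost (d ⊕ e)  = suc (cost d + cost e)
cost (d ⊖ e)  = suc (cost d + cost e)

-- Run W c σ t σ′: started in σ, the program c halts in σ′ after t steps, and
-- every value written and every index written to is below W.  A write that
-- does not fit has no derivation, so large numbers cannot be used to pack
-- several words into one; intermediate values in an expression exceed the
-- stored ones and the program's literals by at most the factor cost e.
-- A test succeeds when its value is nonzero.
data Run (W : ℕ) : Cmd → State → ℕ → State → Set where

  run-skip : ∀ {σ} → Run W skip σ 1 σ

  run-≔ : ∀ {σ x e} →
    eval σ e < W →
    Run W (x ≔ e) σ (suc (cost e)) ⟨ regs σ [ x ↦ eval σ e ] , arrs σ ⟩

  run-← : ∀ {σ a d e} →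
    eval σ d < W →
    eval σ e < W →
    Run W (a at d ← e) σ (suc (cost d + cost e))
      ⟨ regs σ , arrs σ [ a ↦ arrs σ a [ eval σ d ↦ eval σ e ] ] ⟩

  run-⨾ : ∀ {σ σ′ σ″ t t′ c d} →
    Run W c σ t σ′ →
    Run W d σ′ t′ σ″ →
    Run W (c ⨾ d) σ (t + t′) σ″

  run-then : ∀ {σ σ′ t e c d} →
    eval σ e ≢ 0 →
    Run W c σ t σ′ →
    Run W (test e then c else d) σ (suc (cost e + t)) σ′

  run-else : ∀ {σ σ′ t e c d} →
    eval σ e ≡ 0 →
    Run W d σ t σ′ →
    Run W (test e then c else d) σ (suc (cost e + t)) σ′

  run-stop : ∀ {σ e c} →
    eval σ e ≡ 0 →
    Run W (while e loop c) σ (suc (cost e)) σ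

  run-loop : ∀ {σ σ′ σ″ t t′ e c} →
    eval σ e ≢ 0 →
    Run W c σ t σ′ →
    Run W (while e loop c) σ′ t′ σ″ →
    Run W (while e loop c) σ (suc (cost e + (t + t′))) σ″

record AdjacencyLists {n} (G : Graph (Fin n)) : Set where
  field
    neighbours : Fin n → List (Fin n)
    unique     : ∀ v → Unique (neighbours v)
    correct    : ∀ v w → (w ∈ˡ neighbours v) ⇔ Adj G v w

load : List ℕ → ℕ → ℕ
load []       _       = 0
load (x ∷ xs) zero    = x
load (x ∷ xs) (suc i) = load xs i

-- Register 0 holds n.  Array 1 is the concatenation of the adjacency lists of
-- vertices 0, …, n − 1; that of v occupies the positions i with
-- array 0 [v] ≤ i < array 0 [v + 1].  All other memory is zero.
input : ∀ {n} {G : Graph (Fin n)} → AdjacencyLists G → State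
input {n} L = ⟨ registers , arrays ⟩
  where
  lists : List (List (Fin n))
  lists = map (AdjacencyLists.neighbours L) (allFin n)

  registers : ℕ → ℕ
  registers zero    = n
  registers (suc _) = 0

  arrays : ℕ → ℕ → ℕ
  arrays 0             = load (scanl _+_ 0 (map length lists))
  arrays 1             = load (map toℕ (concat lists))
  arrays (suc (suc _)) = λ _ → 0

-- Array 2 is the characteristic vector of A.
Outputs : ∀ {n} → State → Subset n → Set
Outputs σ A = ∀ v → arrs σ 2 (toℕ v) ≡ (if lookup A v then 1 else 0)

-- Linear time is the case W = T = c (n + 1) with c independent of the graph;
-- this W amounts to words of log₂ n + O(1) bits.
FindsNearBipartite : ∀ {n} {G : Graph (Fin n)} → (W T : ℕ) → Cmd → AdjacencyLists G → Set
FindsNearBipartite {n} {G} W T p L =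
  Σ ℕ λ t → Σ State λ σ → Run W p (input L) t σ × t ≤ T ×
  Σ (Subset n) λ A → Σ (Subset n) λ B → IsNearBipartite G A B × Outputs σ A

{-# OPTIONS --safe #-}

-- The vertices are coloured in the reverse of a search order, so that every vertex but the root
-- of its component still has an uncoloured neighbour when its turn comes.  A vertex w is put in
-- B and inspected: without a neighbour in A it is moved to A, and with at most one neighbour in
-- B it lies on no cycle of B.  Otherwise w is a root with one neighbour a in A and two in B, and
-- the only cycle B can contain passes through w.  Follow it from w, inspecting each vertex in
-- the same way.  If the walk closes up, move its last vertex to A and its A-neighbour to B (the
-- new hole), and walk on from there.
--
-- The walks take linear time because the cycles closed in one component are disjoint, with one
-- exception at the end: if a walk runs into an old cycle C and closes, it has covered all of C
-- but the vertex that was moved to A, and closing up once more would exhibit a K₄.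

module Submission where

open import Defs
open import Data.Bool.Base using (true; false; if_then_else_; Bool)
open import Data.Fin.Base using (Fin; zero; suc; toℕ; fromℕ<)
open import Data.Fin.Properties using (toℕ<n; toℕ-injective; toℕ-fromℕ<) renaming (_≟_ to _≟ᶠ_)
open import Data.Fin.Subset using (Subset; _∈_)
open import Data.Fin.Subset.Properties using (⊆-antisym; ⊆⊤; ⊥⊆; x∈p∪q⁺; x∈p∩q⁻)
open import Data.List.Base as List using (List; []; _∷_; _++_; _∷ʳ_; [_]; length; filter; map; concat; allFin; foldl; inits; tabulate; InitLast; initLast; _∷ʳ′_)
open import Data.List.Membership.DecPropositional using (_∈?_)
open import Data.List.Membership.Propositional using () renaming (_∈_ to _∈ˡ_; _∉_ to _∉ˡ_)
open import Data.List.Membership.Propositional.Properties using (∈-∃++; ∈-++⁻; ∈-++⁺ˡ; ∈-++⁺ʳ; ∈-filter⁺; ∈-allFin; ∈-filter⁻; ∈-concat⁺′; ∈-concat⁻′; ∈-tabulate⁺; ∈-tabulate⁻)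
open import Data.List.Properties using (map-∘; map-tabulate; map-++; length-++; ++-assoc; length-map; length-++-sucʳ; length-tabulate)
open import Data.List.Relation.Unary.All as All using (All; []; _∷_)
open import Data.List.Relation.Unary.All.Properties using (¬Any⇒All¬) renaming (map⁺ to all-map⁺)
open import Data.List.Relation.Unary.AllPairs using ([]; _∷_)
open import Data.List.Relation.Unary.Any using (here; there)
open import Data.List.Relation.Unary.Linked as Linked using (Linked; []; _∷_)
open import Data.List.Relation.Unary.Linked.Properties using () renaming (map⁺ to linked-map⁺)
open import Data.List.Relation.Unary.Unique.Propositional using (Unique)
open import Data.List.Relation.Unary.Unique.Propositional.Properties using (Unique[x∷xs]⇒x∉xs) renaming (++⁺ to unique-++⁺; filter⁺ to unique-filter⁺; map⁺ to unique-map⁺; tabulate⁺ to unique-tabulate⁺)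
open import Data.List.Scans.Base using (scanl)
open import Data.List.Scans.Properties using (scanl-defn)
open import Data.Maybe.Base using (Maybe; just; nothing; maybe′)
open import Data.Maybe.Properties using (just-injective)
open import Data.Nat.Base using (ℕ; zero; suc; _+_; _*_; _∸_; _<_; _≤_; _≡ᵇ_; z≤n; s≤s)
open import Data.Nat.ListAction using (sum)
open import Data.Nat.ListAction.Properties using (sum-++)
open import Data.Nat.Properties
open import Data.Nat.Tactic.RingSolver using (solve-∀)
open import Data.Product.Base using (Σ; ∃; ∃₂; _×_; _,_; proj₁; proj₂; ∃-syntax)
open import Data.Sum.Base using (_⊎_; inj₁; inj₂)
open import Data.Unit.Base using (tt)
import Data.Vec.Base as Vec
open import Data.Vec.Properties using (lookup∘tabulate; lookup⇒[]=; []=⇒lookup)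
open import Data.Vec.Properties.WithK using ([]=-irrelevant)
open import Function.Base using (id; _∘_)
open import Function.Bundles using (Equivalence; mk⇔; mk↔ₛ′)
open import Relation.Binary.Construct.Closure.ReflexiveTransitive using (Star; ε; _◅_)
open import Relation.Binary.PropositionalEquality using (_≡_; _≢_; refl; sym; trans; cong; cong₂; subst; subst₂)
open import Relation.Nullary.Decidable using (yes; no; does; ¬?; Dec; dec-true)
open import Relation.Nullary.Negation using (¬_; contradiction)

-- Correctness and running time rest on different invariants. For correctness it suffices that every
-- cycle of B contains the current vertex `w`. If `w` has exactly two neighbours in B, such a cycle
-- contains both of them, so the walk may go on to either. Moving `w` to A destroys every cycle, and
-- moving its A-neighbour `a` to B afterwards creates only cycles through `a`. The process is
-- therefore safe however long it runs.
--
-- The obstacle is that nothing so far keeps it from circling for ever. What has to be tracked is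
-- how a closed cycle looks from outside: the part of it that stays in B has no B-neighbour beyond
-- the cycle except the present hole. Such a cycle can be entered only by the first step after a
-- swap and left only into the hole, so a trail either misses all old cycles or lies, but for its
-- hole, on a single one.
--
-- For this reason the process is first treated as a transition system with a step budget, free of
-- registers and arrays; the program is then shown to perform its transitions at constant cost each.

-- Timed correctness rules for commands

-- Bounds the running time of loop-free commands; loops get the junk value 0.
bound : Cmd → ℕ
bound skip                   = 1
bound (x ≔ e)                = suc (cost e)
bound (a at d ← e)           = suc (cost d + cost e)
bound (c ⨾ d)                = bound c + bound d
bound (test e then c else d) = suc (cost e + (bound c + bound d))
bound (while e loop c)       = 0

Ends : ℕ → ℕ → Cmd → State → (State → Set) → Set
Ends W T c σ Q = Σ ℕ λ t → Σ State λ σ′ → Run W c σ t σ′ × t ≤ T × Q σ′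

⟪_⟫ : ℕ → Cmd → State → (State → Set) → Set
⟪ W ⟫ c = Ends W (bound c) c

weaken : ∀ {W T c σ} {Q R : State → Set} → Ends W T c σ Q → (∀ {σ′} → Q σ′ → R σ′) → Ends W T c σ R
weaken (t , σ′ , run , le , q) f = t , σ′ , run , le , f q

module _ {W : ℕ} {Q : State → Set} where

  skipping : ∀ {σ} → Q σ → ⟪ W ⟫ skip σ Q
  skipping q = _ , _ , run-skip , ≤-refl , q

  assign : ∀ {σ x e} → eval σ e < W → Q ⟨ regs σ [ x ↦ eval σ e ] , arrs σ ⟩ → ⟪ W ⟫ (x ≔ e) σ Q
  assign lt q = _ , _ , run-≔ lt , ≤-refl , q

  store : ∀ {σ a d e} → eval σ d < W → eval σ e < W →
    Q ⟨ regs σ , arrs σ [ a ↦ arrs σ a [ eval σ d ↦ eval σ e ] ] ⟩ → ⟪ W ⟫ (a at d ← e) σ Q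
  store lt lt′ q = _ , _ , run-← lt lt′ , ≤-refl , q

  infixr 3 _then_
  _then_ : ∀ {R : State → Set} {S T σ c d} → Ends W S c σ R →
    (∀ {σ′} → R σ′ → Ends W T d σ′ Q) → Ends W (S + T) (c ⨾ d) σ Q
  (_ , _ , run , le , r) then k with k r
  ... | _ , _ , run′ , le′ , q = _ , _ , run-⨾ run run′ , +-mono-≤ le le′ , q

  -- Unlike `_then_`, this hands on the explicit state after the assignment, so that reading a
  -- register or array with a literal name computes and most side conditions later close by `refl`.
  assign⨾ : ∀ {T σ x e d} → eval σ e < W → Ends W T d ⟨ regs σ [ x ↦ eval σ e ] , arrs σ ⟩ Q →
    Ends W (suc (cost e) + T) (x ≔ e ⨾ d) σ Q
  assign⨾ lt (_ , _ , run , le , q) = _ , _ , run-⨾ (run-≔ lt) run , +-monoʳ-≤ _ le , q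

  store⨾ : ∀ {T σ a i e d} → eval σ i < W → eval σ e < W →
    Ends W T d ⟨ regs σ , arrs σ [ a ↦ arrs σ a [ eval σ i ↦ eval σ e ] ] ⟩ Q →
    Ends W (suc (cost i + cost e) + T) (a at i ← e ⨾ d) σ Q
  store⨾ lt lt′ (_ , _ , run , le , q) = _ , _ , run-⨾ (run-← lt lt′) run , +-monoʳ-≤ _ le , q

  -- `bound` charges for both branches, so whichever is taken is covered without comparing the two.
  branch : ∀ {σ e c d} → (eval σ e ≢ 0 → ⟪ W ⟫ c σ Q) → (eval σ e ≡ 0 → ⟪ W ⟫ d σ Q) →
    ⟪ W ⟫ (test e then c else d) σ Q
  branch {σ} {e} {c} {d} f g with eval σ e ≟ 0
  ... | no ≢0 with f ≢0
  ...   | _ , _ , run , le , q =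
          _ , _ , run-then ≢0 run , s≤s (+-monoʳ-≤ (cost e) (m≤n⇒m≤n+o (bound d) le)) , q
  branch {σ} {e} {c} {d} f g | yes ≡0 with g ≡0
  ...   | _ , _ , run , le , q =
          _ , _ , run-else ≡0 run , s≤s (+-monoʳ-≤ (cost e) (m≤n⇒m≤o+n (bound c) le)) , q

  -- m bounds the number of iterations still to come.
  iterate : ∀ {e c} (Inv : ℕ → State → Set) →
    (∀ m σ → Inv m σ →
      (eval σ e ≡ 0 × Q σ) ⊎ (eval σ e ≢ 0 × ∃ λ m′ → m ≡ suc m′ × ⟪ W ⟫ c σ (Inv m′))) →
    ∀ m {σ} → Inv m σ → Ends W (suc m * suc (cost e + bound c)) (while e loop c) σ Q
  iterate {e} {c} Inv step m {σ} inv with step m σ inv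
  ... | inj₁ (≡0 , q) =
        _ , _ , run-stop ≡0 , ≤-trans (s≤s (m≤m+n (cost e) (bound c))) (m≤m+n _ _) , q
  ... | inj₂ (≢0 , m′ , refl , _ , _ , run , le , inv′) with iterate Inv step m′ inv′
  ...   | _ , _ , run′ , le′ , q = _ , _ , run-loop ≢0 run run′ ,
          ≤-trans (≤-reflexive (cong suc (sym (+-assoc (cost e) _ _))))
            (+-mono-≤ (s≤s (+-monoʳ-≤ (cost e) le)) le′) , q

update-≡ : ∀ {X : Set} (f : ℕ → X) k x → (f [ k ↦ x ]) k ≡ x
update-≡ f k x with k ≡ᵇ k | ≡⇒≡ᵇ k k refl
... | true | _ = refl

update-≢ : ∀ {X : Set} (f : ℕ → X) {k j} x → j ≢ k → (f [ k ↦ x ]) j ≡ f j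
update-≢ f {k} {j} x j≢k with j ≡ᵇ k | ≡ᵇ⇒≡ j k
... | true  | j≡k = contradiction (j≡k tt) j≢k
... | false | _   = refl

-- The pigeonhole principle. It yields every count below: three neighbours at most, a queue of at
-- most `n` entries, and walks no longer than the ground they cover.
unique-⊆⇒length≤ : ∀ {X : Set} {xs ys : List X} → Unique xs → (∀ {x} → x ∈ˡ xs → x ∈ˡ ys) → length xs ≤ length ys
unique-⊆⇒length≤ []         sub = z≤n
unique-⊆⇒length≤ {xs = x ∷ xs} u@(_ ∷ u′) sub with ∈-∃++ (sub (here refl))
... | ps , qs , refl = ≤-trans (s≤s (unique-⊆⇒length≤ u′ sub′)) (≤-reflexive (sym (length-++-sucʳ ps x qs)))
  where
  sub′ : ∀ {y} → y ∈ˡ xs → y ∈ˡ ps ++ qs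
  sub′ y∈xs with ∈-++⁻ ps (sub (there y∈xs))
  ... | inj₁ y∈ps         = ∈-++⁺ˡ y∈ps
  ... | inj₂ (here refl)  = contradiction y∈xs (Unique[x∷xs]⇒x∉xs u)
  ... | inj₂ (there y∈qs) = ∈-++⁺ʳ ps y∈qs

-- Adjacency lists in memory

slot : ∀ {X : Set} → List X → ℕ → Maybe X
slot []       _       = nothing
slot (x ∷ xs) zero    = just x
slot (x ∷ xs) (suc k) = slot xs k

-- nothing stands for a missing neighbour; it is sent to the spare cell n, which no vertex uses.
address : ∀ {n} → Maybe (Fin n) → ℕ
address {n} nothing  = n
address     (just v) = toℕ v

address≤n : ∀ {n} (s : Maybe (Fin n)) → address s ≤ n
address≤n nothing  = ≤-refl
address≤n (just v) = <⇒≤ (toℕ<n v)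

slot-beyond : ∀ {X : Set} (xs : List X) k → length xs ∸ k ≡ 0 → slot xs k ≡ nothing
slot-beyond []       k       eq = refl
slot-beyond (x ∷ xs) (suc k) eq = slot-beyond xs k eq

load-concat : ∀ {n} (xs : List (Fin n)) {ys} k → length xs ∸ k ≢ 0 →
  load (map toℕ (xs ++ ys)) k ≡ address (slot xs k)
load-concat []       k       ≢0 = contradiction (0∸n≡0 k) ≢0
load-concat (x ∷ xs) zero    ≢0 = refl
load-concat (x ∷ xs) (suc k) ≢0 = load-concat xs k ≢0

foldl-+ : ∀ m ks → foldl _+_ m ks ≡ m + sum ks
foldl-+ m []       = sym (+-identityʳ m)
foldl-+ m (k ∷ ks) = trans (foldl-+ (m + k) ks) (+-assoc m k (sum ks))

-- `scanl-defn` rewrites the scan as folds over the initial segments, and the segment at index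
-- `length ks` is `ks` itself.
load-scanl : ∀ m ks {ls} → load (scanl _+_ m (ks ++ ls)) (length ks) ≡ m + sum ks
load-scanl m ks {ls} = trans (cong (λ js → load js (length ks)) (scanl-defn _+_ m (ks ++ ls))) (go m ks)
  where
  go : ∀ m ks → load (map (foldl _+_ m) (inits (ks ++ ls))) (length ks) ≡ m + sum ks
  go m []       = sym (+-identityʳ m)
  go m (k ∷ ks) = trans (cong (λ js → load js (length ks)) (sym (map-∘ (inits (ks ++ ls)))))
    (trans (go (m + k) ks) (+-assoc m k (sum ks)))

load-concat-skip : ∀ {n} (pre : List (List (Fin n))) post k →
  load (map toℕ (concat (pre ++ post))) (sum (map length pre) + k) ≡ load (map toℕ (concat post)) k
load-concat-skip []         post k = refl
load-concat-skip {n} (xs ∷ pre) post k = trans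
  (cong (load (map toℕ (xs ++ concat (pre ++ post)))) (+-assoc (length xs) (sum (map length pre)) k))
  (trans (skip-list xs (concat (pre ++ post)) _) (load-concat-skip pre post k))
  where
  skip-list : ∀ (xs zs : List (Fin n)) j → load (map toℕ (xs ++ zs)) (length xs + j) ≡ load (map toℕ zs) j
  skip-list []       zs j = refl
  skip-list (_ ∷ xs) zs j = skip-list xs zs j

tabulate-split : ∀ {X : Set} {n} (f : Fin n → X) i →
  ∃₂ λ pre post → tabulate f ≡ pre ++ f i ∷ post × length pre ≡ toℕ i
tabulate-split f zero    = [] , _ , refl , refl
tabulate-split f (suc i) with tabulate-split (f ∘ suc) i
... | pre , post , eq , len = f zero ∷ pre , post , cong (f zero ∷_) eq , cong suc len

-- Registers: rN holds n, rW the current vertex, rX, rY and rZ its neighbours, rP the previous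
-- vertex and rH the hole of the walk, rI the length of the queue, rM whether a walk is under
-- way, rS the next root and rE the head of the search, rA a neighbour in A, rT the next vertex.
-- Arrays: aA and aB are the characteristic vectors of A and B, aV marks visited vertices, aQ
-- is the queue.

pattern rN = 0
pattern rW = 1
pattern rX = 2
pattern rY = 3
pattern rZ = 4
pattern rP = 5
pattern rH = 6
pattern rI = 7
pattern rM = 8
pattern rS = 9
pattern rE = 10
pattern rA = 11
pattern rT = 12

pattern aA = 2
pattern aB = 3
pattern aV = 4
pattern aQ = 5

degreeExpr : Expr
degreeExpr = 0 at (reg rW ⊕ lit 1) ⊖ 0 at reg rW

-- The test is nonzero exactly when `k` is below the degree. Otherwise the register receives `n`,
-- the address of `nothing`, and not an entry of the next vertex's list.
fetch₁ : ℕ → ℕ → Cmd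
fetch₁ k r = test degreeExpr ⊖ lit k then r ≔ 1 at (0 at reg rW ⊕ lit k) else r ≔ reg rN

fetch : Cmd
fetch = fetch₁ 0 rX ⨾ fetch₁ 1 rY ⨾ fetch₁ 2 rZ

module Lists {n : ℕ} {G : Graph (Fin n)} (L : AdjacencyLists G) (subcubic : Subcubic G) where
  open AdjacencyLists L public

  length-neighbours : ∀ v → length (neighbours v) ≤ 3
  length-neighbours v = ≤-trans
    (unique-⊆⇒length≤ (unique v) λ w∈ → ∈-filter⁺ (Graph.adj? G v) (∈-allFin _) (Equivalence.to (correct v _) w∈))
    (subcubic v)

  record Memory (σ : State) : Set where
    field
      size    : regs σ rN ≡ n
      offsets : arrs σ 0 ≡ arrs (input L) 0
      entries : arrs σ 1 ≡ arrs (input L) 1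

  open Memory public

  remember : ∀ {σ ρ α} → Memory σ → ρ rN ≡ regs σ rN → α 0 ≡ arrs σ 0 → α 1 ≡ arrs σ 1 → Memory ⟨ ρ , α ⟩
  remember mem eqN eq₀ eq₁ = record
    { size = trans eqN (size mem) ; offsets = trans eq₀ (offsets mem) ; entries = trans eq₁ (entries mem) }

  module _ (v : Fin n) where
    private
      split = tabulate-split neighbours v
      pre   = proj₁ split
      post  = proj₁ (proj₂ split)

      lists≡ : map neighbours (allFin n) ≡ pre ++ neighbours v ∷ post
      lists≡ = trans (map-tabulate id neighbours) (proj₁ (proj₂ (proj₂ split)))

      len : length pre ≡ toℕ v
      len = proj₂ (proj₂ (proj₂ split))

      offset : ℕ
      offset = sum (map length pre)

    offset≡ : arrs (input L) 0 (toℕ v) ≡ offset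
    offset≡ = trans
      (cong₂ (λ ls → load (scanl _+_ 0 ls)) (trans (cong (map length) lists≡) (map-++ length pre _))
        (trans (sym len) (sym (length-map length pre))))
      (load-scanl 0 (map length pre))

    -- The same prefix sum, with the list of `v` itself appended to the prefix.
    offset-suc≡ : arrs (input L) 0 (suc (toℕ v)) ≡ length (neighbours v) + offset
    offset-suc≡ = trans
      (cong₂ (λ ls → load (scanl _+_ 0 ls))
        (trans (cong (map length) lists≡) (trans (map-++ length pre _) (sym (++-assoc (map length pre) [ d ] _))))
        (trans (cong suc (trans (sym len) (sym (length-map length pre))))
          (sym (trans (length-++ (map length pre)) (+-comm _ 1)))))
      (trans (load-scanl 0 (map length pre ∷ʳ d))
        (trans (sum-++ (map length pre) [ d ]) (trans (cong (offset +_) (+-identityʳ d)) (+-comm offset d))))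
      where
      d = length (neighbours v)

    degree≡ : arrs (input L) 0 (toℕ v + 1) ∸ arrs (input L) 0 (toℕ v) ≡ length (neighbours v)
    degree≡ = trans
      (cong₂ _∸_ (trans (cong (arrs (input L) 0) (+-comm (toℕ v) 1)) offset-suc≡) offset≡)
      (m+n∸n≡m _ offset)

    entry≡ : ∀ k → length (neighbours v) ∸ k ≢ 0 →
      arrs (input L) 1 (arrs (input L) 0 (toℕ v) + k) ≡ address (slot (neighbours v) k)
    entry≡ k ≢0 = trans
      (cong₂ (λ ls i → load (map toℕ (concat ls)) (i + k)) lists≡ offset≡)
      (trans (load-concat-skip pre _ k) (load-concat (neighbours v) k ≢0))

  module _ {W : ℕ} (n<W : n < W) where

    address<W : (s : Maybe (Fin n)) → address s < W
    address<W s = ≤-<-trans (address≤n s) n<W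

    fetch₁-correct : ∀ k r {σ} v {Q} → Memory σ → regs σ rW ≡ toℕ v →
      Q ⟨ regs σ [ r ↦ address (slot (neighbours v) k) ] , arrs σ ⟩ → ⟪ W ⟫ (fetch₁ k r) σ Q
    fetch₁-correct k r {σ} v {Q} mem w≡ q = branch
      (λ ≢0 → write (trans (entry-eval) (entry≡ v k (λ ≡0 → ≢0 (trans test≡ ≡0)))))
      (λ ≡0 → write (trans (size mem) (cong address (sym (slot-beyond (neighbours v) k (trans (sym test≡) ≡0))))))
      where
      test≡ : eval σ (degreeExpr ⊖ lit k) ≡ length (neighbours v) ∸ k
      test≡ rewrite w≡ | offsets mem = cong (_∸ k) (degree≡ v)
      entry-eval : eval σ (1 at (0 at reg rW ⊕ lit k)) ≡ arrs (input L) 1 (arrs (input L) 0 (toℕ v) + k)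
      entry-eval rewrite w≡ | offsets mem | entries mem = refl
      write : ∀ {e} → eval σ e ≡ address (slot (neighbours v) k) → ⟪ W ⟫ (r ≔ e) σ Q
      write eq = assign (subst (_< W) (sym eq) (address<W (slot (neighbours v) k)))
        (subst (λ m → Q ⟨ regs σ [ r ↦ m ] , arrs σ ⟩) (sym eq) q)

    fetch-correct : ∀ {σ} v {Q} → Memory σ → regs σ rW ≡ toℕ v →
      (let s = slot (neighbours v)) →
      Q ⟨ ((regs σ [ rX ↦ address (s 0) ]) [ rY ↦ address (s 1) ]) [ rZ ↦ address (s 2) ] , arrs σ ⟩ →
      ⟪ W ⟫ fetch σ Q
    fetch-correct {σ} v {Q} mem w≡ q =
      -- The postcondition `_≡ σ₁` names the resulting state; matching it with `refl` lets the
      -- following command be checked at a concrete state.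
      fetch₁-correct 0 rX {σ} v {_≡ σ₁} mem w≡ refl then λ { refl →
      fetch₁-correct 1 rY {σ₁} v {_≡ σ₂} mem₁ w≡ refl then λ { refl →
      fetch₁-correct 2 rZ {σ₂} v mem₂ w≡ q } }
      where
      s : ℕ → Maybe (Fin n)
      s = slot (neighbours v)
      σ₁ = ⟨ regs σ [ rX ↦ address (s 0) ] , arrs σ ⟩
      σ₂ = ⟨ (regs σ [ rX ↦ address (s 0) ]) [ rY ↦ address (s 1) ] , arrs σ ⟩
      mem₁ : Memory σ₁
      mem₁ = remember mem refl refl refl
      mem₂ : Memory σ₂
      mem₂ = remember mem refl refl refl

length≤n : ∀ {n} {vs : List (Fin n)} → Unique vs → length vs ≤ n
length≤n {n} u = ≤-trans (unique-⊆⇒length≤ u λ {v} _ → ∈-allFin v) (≤-reflexive (length-tabulate {n = n} id))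

∈⇒slot : ∀ {X : Set} {x : X} {xs} → length xs ≤ 3 → x ∈ˡ xs →
  slot xs 0 ≡ just x ⊎ slot xs 1 ≡ just x ⊎ slot xs 2 ≡ just x
∈⇒slot le (here refl)                 = inj₁ refl
∈⇒slot le (there (here refl))         = inj₂ (inj₁ refl)
∈⇒slot le (there (there (here refl))) = inj₂ (inj₂ refl)
∈⇒slot (s≤s (s≤s (s≤s ()))) (there (there (there (here _))))
∈⇒slot (s≤s (s≤s (s≤s ()))) (there (there (there (there _))))

slot⇒∈ : ∀ {X : Set} {x : X} xs k → slot xs k ≡ just x → x ∈ˡ xs
slot⇒∈ (x ∷ xs) zero    refl = here refl
slot⇒∈ (x ∷ xs) (suc k) eq   = there (slot⇒∈ xs k eq)

-- The search order

-- Queues are listed from the newest entry to the oldest.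
data Stored {n} (cells : ℕ → ℕ) : List (Fin n) → Set where
  []  : Stored cells []
  _∷_ : ∀ {v q} → cells (length q) ≡ toℕ v → Stored cells q → Stored cells (v ∷ q)

stored-lookup : ∀ {n} {cells} p {v : Fin n} {q} → Stored cells (p ++ v ∷ q) → cells (length q) ≡ toℕ v
stored-lookup []      (eq ∷ _) = eq
stored-lookup (_ ∷ p) (_ ∷ st) = stored-lookup p st

stored-extend : ∀ {n} {cells} {q : List (Fin n)} {k x} → length q ≤ k → Stored cells q → Stored (cells [ k ↦ x ]) q
stored-extend lt []        = []
stored-extend {cells = cells} {x = x} lt (eq ∷ st) = trans (update-≢ cells x (<⇒≢ lt)) eq ∷ stored-extend (<⇒≤ lt) st

-- The spare cell `n` is marked before the search begins, so a missing neighbour counts as already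
-- visited.
push : ℕ → Cmd
push r = test aV at reg r then skip
  else (aV at reg r ← lit 1 ⨾ aQ at reg rI ← reg r ⨾ rI ≔ reg rI ⊕ lit 1)

-- Truncated differences serve as comparisons and the sum as a disjunction: an untried root or an
-- unexpanded queue entry remains.
searchGuard : Expr
searchGuard = (reg rN ⊖ reg rS) ⊕ (reg rI ⊖ reg rE)

expand seed searchBody search : Cmd
expand     = rW ≔ aQ at reg rE ⨾ rE ≔ reg rE ⊕ lit 1 ⨾ fetch ⨾ push rX ⨾ push rY ⨾ push rZ
seed       = rX ≔ reg rS ⨾ rS ≔ reg rS ⊕ lit 1 ⨾ push rX
searchBody = test reg rI ⊖ reg rE then expand else seed
search     = while searchGuard loop searchBody

module Search {n : ℕ} {G : Graph (Fin n)} (L : AdjacencyLists G) (subcubic : Subcubic G) where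
  open Lists L subcubic

  Closed : List (Fin n) → Set
  Closed r = ∀ {y z} → y ∈ˡ r → Adj G y z → z ∈ˡ r

  -- Colouring proceeds from the head of the list. In the first case `y` is coloured after `v`. In
  -- the second `r` is a union of components, so a `v` outside `r` is the last vertex of its own
  -- component to be coloured.
  data SearchOrder : List (Fin n) → Set where
    []  : SearchOrder []
    _∷_ : ∀ {v r} → (∃ λ y → y ∈ˡ r × Adj G v y) ⊎ Closed r → SearchOrder r → SearchOrder (v ∷ r)

  record Queue (σ : State) (q : List (Fin n)) : Set where
    field
      memory   : Memory σ
      blankA   : arrs σ aA ≡ λ _ → 0
      blankB   : arrs σ aB ≡ λ _ → 0
      idle     : regs σ rM ≡ 0
      stored   : Stored (arrs σ aQ) q
      tail     : regs σ rI ≡ length q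
      distinct : Unique q
      ordered  : SearchOrder q
      marked   : ∀ v → v ∈ˡ q → arrs σ aV (toℕ v) ≢ 0
      queued   : ∀ v → arrs σ aV (toℕ v) ≢ 0 → v ∈ˡ q
      spare    : arrs σ aV n ≢ 0

  requeue : ∀ {σ q ρ} → Queue σ q → ρ rN ≡ regs σ rN → ρ rI ≡ regs σ rI → ρ rM ≡ regs σ rM → Queue ⟨ ρ , arrs σ ⟩ q
  requeue Q eqN eqI eqM = record
    { memory = remember memory eqN refl refl ; idle = trans eqM idle ; tail = trans eqI tail
    ; blankA = blankA ; blankB = blankB ; stored = stored ; distinct = distinct ; ordered = ordered
    ; marked = marked ; queued = queued ; spare = spare }
    where open Queue Q

  record Pushed (σ : State) (q : List (Fin n)) (s : Maybe (Fin n)) (σ′ : State) : Set where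
    field
      {added}  : List (Fin n)
      queue    : Queue σ′ (added ++ q)
      frame    : ∀ j → j ≢ rI → regs σ′ j ≡ regs σ j
      included : ∀ {v} → s ≡ just v → v ∈ˡ added ++ q

  record Searching (m : ℕ) (σ : State) : Set where
    field
      front done : List (Fin n)
      root       : ℕ
      queue      : Queue σ (front ++ done)
      head       : regs σ rE ≡ length done
      next-root  : regs σ rS ≡ root
      expanded   : ∀ {y z} → y ∈ˡ done → Adj G y z → z ∈ˡ front ++ done
      seeded     : ∀ v → toℕ v < root → v ∈ˡ front ++ done
      -- Each pass of the loop either tries one root or expands one entry, whence the sum.
      budget     : (n ∸ root) + (n ∸ length done) ≤ m

  record Completed (σ : State) : Set where
    field
      order : List (Fin n)
      queue : Queue σ order
      total : ∀ v → v ∈ˡ order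

  module _ {W : ℕ} (n<W : n < W) (1<W : 1 < W) where

    push-correct : ∀ {σ q} r s → r ≢ rI → Queue σ q → regs σ r ≡ address s →
      (∀ {v} → s ≡ just v → (∃ λ y → y ∈ˡ q × Adj G v y) ⊎ Closed q) →
      ⟪ W ⟫ (push r) σ (Pushed σ q s)
    push-correct {σ} r nothing r≢I Q r≡ reason = branch
      (λ _ → skipping record { added = [] ; queue = Q ; frame = λ _ _ → refl ; included = λ () })
      (λ ≡0 → contradiction (trans (cong (arrs σ aV) (sym r≡)) ≡0) (Queue.spare Q))
    push-correct {σ} {q} r (just v) r≢I Q r≡ reason = branch
      (λ ≢0 → skipping record
        { added    = []
        ; queue    = Q
        ; frame    = λ _ _ → refl
        ; included = λ { refl → queued v (subst (λ i → arrs σ aV i ≢ 0) r≡ ≢0) }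
        })
      new
      where
      open Queue Q
      new : arrs σ aV (regs σ r) ≡ 0 → ⟪ W ⟫ _ σ (Pushed σ q (just v))
      new ≡0 =
        store⨾ (subst (_< W) (sym r≡) (address<W n<W (just v))) 1<W (
        store⨾ (subst (_< W) (sym tail) (≤-<-trans (<⇒≤ fresh-fits) n<W))
               (subst (_< W) (sym r≡) (address<W n<W (just v))) (
        assign (subst (_< W) (sym tail+1) (≤-<-trans fresh-fits n<W)) record
          { added    = v ∷ []
          ; frame    = λ j j≢I → update-≢ (regs σ) (regs σ rI + 1) j≢I
          ; included = λ { refl → here refl }
          ; queue    = record
            { memory   = remember memory refl refl refl
            ; blankA   = blankA
            ; blankB   = blankB
            ; idle     = idle
            ; stored   = subst (λ k → Stored (arrs σ aQ [ k ↦ regs σ r ]) (v ∷ q)) (sym tail)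
                           (trans (update-≡ (arrs σ aQ) (length q) _) r≡ ∷ stored-extend ≤-refl stored)
            ; tail     = tail+1
            ; distinct = fresh
            ; ordered  = reason refl ∷ ordered
            ; marked   = λ { w (here refl) → mark-new r≡ ; w (there w∈) → mark-old w (marked w w∈) }
            ; queued   = λ w → unmark w
            ; spare    = mark-old′ n spare
            }
          }))
        where
        v∉q : v ∉ˡ q
        v∉q v∈q = marked v v∈q (trans (cong (arrs σ aV) (sym r≡)) ≡0)
        fresh : Unique (v ∷ q)
        fresh = ¬Any⇒All¬ q v∉q ∷ distinct
        fresh-fits : suc (length q) ≤ n
        fresh-fits = length≤n fresh
        tail+1 : regs σ rI + 1 ≡ suc (length q)
        tail+1 = trans (+-comm _ 1) (cong suc tail)
        marks : ℕ → ℕ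
        marks = arrs σ aV [ regs σ r ↦ 1 ]
        mark-new : ∀ {i} → regs σ r ≡ i → marks i ≢ 0
        mark-new refl ≡0 with trans (sym (update-≡ (arrs σ aV) (regs σ r) 1)) ≡0
        ... | ()
        mark-old′ : ∀ i → arrs σ aV i ≢ 0 → marks i ≢ 0
        mark-old′ i ≢0 ≡0′ = ≢0 (trans (sym (update-≢ (arrs σ aV) 1 (λ { refl → ≢0 ≡0 }))) ≡0′)
        mark-old : ∀ w → arrs σ aV (toℕ w) ≢ 0 → marks (toℕ w) ≢ 0
        mark-old w = mark-old′ (toℕ w)
        unmark : ∀ w → marks (toℕ w) ≢ 0 → w ∈ˡ v ∷ q
        unmark w ≢0 with w ≟ᶠ v
        ... | yes refl = here refl
        ... | no w≢v = there (queued w λ ≡0′ → ≢0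
              (trans (update-≢ (arrs σ aV) 1 (λ eq → w≢v (toℕ-injective (trans eq r≡)))) ≡0′))

    expand-correct : ∀ {m σ} front v done root → Queue σ (front ++ v ∷ done) →
      regs σ rE ≡ length done → regs σ rS ≡ root →
      (∀ {y z} → y ∈ˡ done → Adj G y z → z ∈ˡ front ++ v ∷ done) →
      (∀ w → toℕ w < root → w ∈ˡ front ++ v ∷ done) →
      (n ∸ root) + (n ∸ suc (length done)) ≤ m →
      ⟪ W ⟫ expand σ (Searching m)
    expand-correct {m} {σ} front v done root Q head≡ root≡ expanded seeded budget =
      assign⨾ (subst (_< W) (sym v≡) (address<W n<W (just v))) (
      assign⨾ (subst (_< W) (sym head+1) (≤-<-trans done<n n<W)) (
      fetch-correct n<W {σ₂} v {_≡ σ₃} mem₂ v≡ refl then λ { refl →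
      push-correct rX (s 0) (λ ()) Q₃ refl (reason {0} []) then λ P₀ →
      push-correct rY (s 1) (λ ()) (Pushed.queue P₀) (Pushed.frame P₀ rY (λ ()))
        (reason {1} (Pushed.added P₀)) then λ P₁ →
      finish P₀ P₁ (push-correct rZ (s 2) (λ ()) (Pushed.queue P₁)
        (trans (Pushed.frame P₁ rZ (λ ())) (Pushed.frame P₀ rZ (λ ())))
        (reason² {2} (Pushed.added P₁) (Pushed.added P₀))) }))
      where
      open Queue Q using (memory; stored; distinct)
      s : ℕ → Maybe (Fin n)
      s = slot (neighbours v)
      q = front ++ v ∷ done
      v≡ : arrs σ aQ (regs σ rE) ≡ toℕ v
      v≡ = trans (cong (arrs σ aQ) head≡) (stored-lookup front stored)
      head+1 : regs σ rE + 1 ≡ suc (length done)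
      head+1 = trans (+-comm _ 1) (cong suc head≡)
      done<n : suc (length done) ≤ n
      done<n = ≤-trans (≤-trans (m≤n+m _ (length front)) (≤-reflexive (sym (length-++ front)))) (length≤n distinct)
      σ₁ = ⟨ regs σ [ rW ↦ arrs σ aQ (regs σ rE) ] , arrs σ ⟩
      σ₂ = ⟨ regs σ₁ [ rE ↦ regs σ₁ rE + 1 ] , arrs σ ⟩
      σ₃ = ⟨ ((regs σ₂ [ rX ↦ address (s 0) ]) [ rY ↦ address (s 1) ]) [ rZ ↦ address (s 2) ] , arrs σ ⟩
      mem₂ : Memory σ₂
      mem₂ = remember memory refl refl refl
      Q₃ : Queue σ₃ q
      Q₃ = requeue Q refl refl refl
      adj : ∀ {k w} → s k ≡ just w → Adj G v w
      adj {k} eq = Equivalence.to (correct v _) (slot⇒∈ (neighbours v) k eq)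
      v∈q : v ∈ˡ q
      v∈q = ∈-++⁺ʳ front (here refl)
      reason : ∀ {k} xs {w} → s k ≡ just w → (∃ λ y → y ∈ˡ xs ++ q × Adj G w y) ⊎ Closed (xs ++ q)
      reason {k} xs eq = inj₁ (v , ∈-++⁺ʳ xs v∈q , Graph.sym G (adj {k} eq))
      reason² : ∀ {k} xs ys {w} → s k ≡ just w → (∃ λ y → y ∈ˡ xs ++ ys ++ q × Adj G w y) ⊎ Closed (xs ++ ys ++ q)
      reason² {k} xs ys eq = inj₁ (v , ∈-++⁺ʳ xs (∈-++⁺ʳ ys v∈q) , Graph.sym G (adj {k} eq))
      finish : ∀ {σ₄ σ₅} (P₀ : Pushed σ₃ q (s 0) σ₄) (P₁ : Pushed σ₄ (Pushed.added P₀ ++ q) (s 1) σ₅) →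
        ⟪ W ⟫ (push rZ) σ₅ (Pushed σ₅ (Pushed.added P₁ ++ Pushed.added P₀ ++ q) (s 2)) →
        ⟪ W ⟫ (push rZ) σ₅ (Searching m)
      finish P₀ P₁ (t , σ₆ , run , le , P₂) = t , σ₆ , run , le , record
        { front     = p ++ front
        ; done      = v ∷ done
        ; root      = root
        ; queue     = subst (Queue σ₆) p≡ (Pushed.queue P₂)
        ; head      = trans (frame rE (λ ())) head+1
        ; next-root = trans (frame rS (λ ())) root≡
        ; expanded  = λ where
            (here refl) adj →
              subst (_ ∈ˡ_) p≡ (pushed (∈⇒slot (length-neighbours v) (Equivalence.from (correct v _) adj)))
            (there y∈) adj → subst (_ ∈ˡ_) p≡ (old (expanded y∈ adj))
        ; seeded    = λ w w<root → subst (_ ∈ˡ_) p≡ (old (seeded w w<root))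
        ; budget    = budget
        }
        where
        x₀ = Pushed.added P₀
        x₁ = Pushed.added P₁
        x₂ = Pushed.added P₂
        p = x₂ ++ x₁ ++ x₀
        p≡ : x₂ ++ x₁ ++ x₀ ++ q ≡ (p ++ front) ++ v ∷ done
        p≡ = sym (trans (++-assoc p front _) (trans (++-assoc x₂ (x₁ ++ x₀) _) (cong (x₂ ++_) (++-assoc x₁ x₀ _))))
        frame : ∀ j → j ≢ rI → regs σ₆ j ≡ regs σ₃ j
        frame j j≢ = trans (Pushed.frame P₂ j j≢) (trans (Pushed.frame P₁ j j≢) (Pushed.frame P₀ j j≢))
        old : ∀ {w} → w ∈ˡ q → w ∈ˡ x₂ ++ x₁ ++ x₀ ++ q
        old w∈ = ∈-++⁺ʳ x₂ (∈-++⁺ʳ x₁ (∈-++⁺ʳ x₀ w∈))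
        pushed : ∀ {w} → s 0 ≡ just w ⊎ s 1 ≡ just w ⊎ s 2 ≡ just w → w ∈ˡ x₂ ++ x₁ ++ x₀ ++ q
        pushed (inj₁ eq)        = ∈-++⁺ʳ x₂ (∈-++⁺ʳ x₁ (Pushed.included P₀ eq))
        pushed (inj₂ (inj₁ eq)) = ∈-++⁺ʳ x₂ (Pushed.included P₁ eq)
        pushed (inj₂ (inj₂ eq)) = Pushed.included P₂ eq

    seed-correct : ∀ {m σ} done root → Queue σ done → regs σ rE ≡ length done → regs σ rS ≡ root →
      Closed done → (∀ w → toℕ w < root → w ∈ˡ done) → root < n →
      (n ∸ suc root) + (n ∸ length done) ≤ m →
      ⟪ W ⟫ seed σ (Searching m)
    seed-correct {m} {σ} done root Q head≡ root≡ closed seeded root<n budget =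
      assign⨾ (subst (_< W) (sym root≡) (<-trans root<n n<W)) (
      assign⨾ (subst (_< W) (sym root+1) (≤-<-trans root<n n<W)) (
      finish (push-correct rX (just v) (λ ()) Q₂ v≡ (λ _ → inj₂ closed))))
      where
      open Queue Q using (memory; stored; distinct)
      v : Fin n
      v = fromℕ< root<n
      v≡ : regs σ rS ≡ toℕ v
      v≡ = trans root≡ (sym (toℕ-fromℕ< root<n))
      root+1 : regs σ rS + 1 ≡ suc root
      root+1 = trans (+-comm _ 1) (cong suc root≡)
      σ₁ = ⟨ regs σ [ rX ↦ regs σ rS ] , arrs σ ⟩
      σ₂ = ⟨ regs σ₁ [ rS ↦ regs σ₁ rS + 1 ] , arrs σ ⟩
      Q₂ : Queue σ₂ done
      Q₂ = requeue Q refl refl refl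
      finish : ⟪ W ⟫ (push rX) σ₂ (Pushed σ₂ done (just v)) → ⟪ W ⟫ (push rX) σ₂ (Searching m)
      finish (t , σ₃ , run , le , P) = t , σ₃ , run , le , record
        { front     = added
        ; done      = done
        ; root      = suc root
        ; queue     = queue
        ; head      = trans (frame rE (λ ())) head≡
        ; next-root = trans (frame rS (λ ())) root+1
        ; expanded  = λ y∈ adj → ∈-++⁺ʳ added (closed y∈ adj)
        ; seeded    = seeded′
        ; budget    = budget
        }
        where
        open Pushed P
        seeded′ : ∀ w → toℕ w < suc root → w ∈ˡ added ++ done
        seeded′ w (s≤s w≤root) with m≤n⇒m<n∨m≡n w≤root
        ... | inj₁ w<root = ∈-++⁺ʳ added (seeded w w<root)
        ... | inj₂ w≡root = included (cong just (toℕ-injective (trans (toℕ-fromℕ< root<n) (sym w≡root))))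

    search-step : ∀ m σ → Searching m σ →
      (eval σ searchGuard ≡ 0 × Completed σ) ⊎
      (eval σ searchGuard ≢ 0 × ∃ λ m′ → m ≡ suc m′ × ⟪ W ⟫ searchBody σ (Searching m′))
    -- Lists run from new to old, so the entry to be expanded next is the last one of `front`.
    search-step m σ I = cases (initLast front) refl
      where
      open Searching I
      size≡ : regs σ rN ≡ n
      size≡ = size (Queue.memory queue)
      cases : ∀ {f} → InitLast f → front ≡ f → _
      cases (f ∷ʳ′ v) refl = inj₂ (guard≢0 , step m budget′)
        where
        eq : (f ∷ʳ v) ++ done ≡ f ++ v ∷ done
        eq = ++-assoc f (v ∷ []) done
        q = subst (Queue σ) eq queue
        pending : regs σ rI ∸ regs σ rE ≢ 0
        pending ≡0 = contradiction (m∸n≡0⇒m≤n ≡0) (<⇒≱ (both head (Queue.tail q)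
          (≤-trans (m≤n+m (suc (length done)) (length f)) (≤-reflexive (sym (length-++ f))))))
          where
          both : ∀ {a b c d} → a ≡ b → c ≡ d → b < d → a < c
          both refl refl lt = lt
        guard≢0 : eval σ searchGuard ≢ 0
        guard≢0 ≡0 = pending (m+n≡0⇒n≡0 (regs σ rN ∸ regs σ rS) ≡0)
        done<n : length done < n
        done<n = ≤-trans (≤-trans (m≤n+m _ (length f)) (≤-reflexive (sym (length-++ f))))
            (length≤n (Queue.distinct q))
        budget′ : suc ((n ∸ root) + (n ∸ suc (length done))) ≤ m
        budget′ = ≤-trans (≤-reflexive
          (trans (sym (+-suc (n ∸ root) _)) (cong (n ∸ root +_) (sym (+-∸-assoc 1 done<n))))) budget
        step : ∀ m → suc ((n ∸ root) + (n ∸ suc (length done))) ≤ m →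
          ∃ λ m′ → m ≡ suc m′ × ⟪ W ⟫ searchBody σ (Searching m′)
        step (suc m′) (s≤s b) = m′ , refl , branch
          (λ _ → expand-correct f v done root q head next-root
            (λ y∈ adj → subst (_ ∈ˡ_) eq (expanded y∈ adj)) (λ w lt → subst (_ ∈ˡ_) eq (seeded w lt)) b)
          (λ ≡0 → contradiction ≡0 pending)
      cases [] refl with <-≤-connex root n
      ... | inj₁ root<n = inj₂ (guard≢0 , step m budget′)
        where
        guard≢0 : eval σ searchGuard ≢ 0
        guard≢0 ≡0 = contradiction (m∸n≡0⇒m≤n (trans (sym (cong₂ _∸_ size≡ next-root)) (m+n≡0⇒m≡0 _ ≡0))) (<⇒≱ root<n)
        budget′ : suc ((n ∸ suc root) + (n ∸ length done)) ≤ m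
        budget′ = ≤-trans (≤-reflexive (cong (_+ (n ∸ length done)) (sym (+-∸-assoc 1 root<n)))) budget
        step : ∀ m → suc ((n ∸ suc root) + (n ∸ length done)) ≤ m →
          ∃ λ m′ → m ≡ suc m′ × ⟪ W ⟫ searchBody σ (Searching m′)
        step (suc m′) (s≤s b) = m′ , refl , branch
          (λ ≢0 → contradiction (trans (cong₂ _∸_ (Queue.tail queue) head) (n∸n≡0 (length done))) ≢0)
          (λ _ → seed-correct done root queue head next-root expanded seeded root<n b)
      ... | inj₂ n≤root = inj₁
        ( cong₂ _+_ (trans (cong₂ _∸_ size≡ next-root) (m≤n⇒m∸n≡0 n≤root))
                    (trans (cong₂ _∸_ (Queue.tail queue) head) (n∸n≡0 (length done)))
        , record { order = done ; queue = queue ; total = λ v → seeded v (<-≤-trans (toℕ<n v) n≤root) })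

    initialise-correct : ⟪ W ⟫ (aV at reg rN ← lit 1) (input L) (Searching (n + n))
    initialise-correct = store n<W 1<W record
      { front = [] ; done = [] ; root = 0 ; head = refl ; next-root = refl
      ; expanded = λ () ; seeded = λ _ () ; budget = ≤-refl
      ; queue = record
        { memory = record { size = refl ; offsets = refl ; entries = refl }
        ; blankA = refl ; blankB = refl ; idle = refl ; stored = [] ; tail = refl ; distinct = [] ; ordered = []
        ; marked = λ _ ()
        ; queued = λ v ≢0 → contradiction (update-≢ (λ _ → 0) 1 (<⇒≢ (toℕ<n v))) ≢0
        ; spare = λ ≡0 → contradiction (trans (sym (update-≡ (λ _ → 0) n 1)) ≡0) λ ()
        }
      }

    search-correct : ∀ {σ} → Searching (n + n) σ →
      Ends W (suc (n + n) * suc (cost searchGuard + bound searchBody)) search σ Completed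
    search-correct = iterate Searching search-step (n + n)

-- Neighbours along a cycle

unique-++⁻ : ∀ {X : Set} {x : X} xs {ys} → Unique (xs ++ ys) → x ∈ˡ xs → x ∉ˡ ys
unique-++⁻ (x ∷ xs) u       (here refl) x∈ys = Unique[x∷xs]⇒x∉xs u (∈-++⁺ʳ xs x∈ys)
unique-++⁻ (x ∷ xs) (_ ∷ u) (there x∈)  x∈ys = unique-++⁻ xs u x∈ x∈ys

linked-++⁻ : ∀ {X : Set} {R : X → X → Set} xs {x y ys} → Linked R (xs ++ x ∷ y ∷ ys) → R x y
linked-++⁻ []           (r ∷ _)  = r
linked-++⁻ (x ∷ [])     (_ ∷ rs) = linked-++⁻ [] rs
linked-++⁻ (x ∷ y ∷ xs) (_ ∷ rs) = linked-++⁻ (y ∷ xs) rs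

snoc-view : ∀ {X : Set} (x : X) xs → ∃₂ λ ys y → x ∷ xs ≡ ys ∷ʳ y
snoc-view x []       = [] , x , refl
snoc-view x (z ∷ xs) with snoc-view z xs
... | ys , y , eq = x ∷ ys , y , cong (x ∷_) eq

-- The two neighbours are the predecessor and the successor in the closed list. The base vertex and
-- the last vertex are separate cases because the list wraps around there, and in both it is the
-- length of at least two that keeps the neighbours distinct.
cycle-neighbours : ∀ {V : Set} (G : Graph V) {v us w} → IsCycle G v us → w ∈ˡ v ∷ us →
  ∃₂ λ x y → x ≢ y × (Adj G w x × x ∈ˡ v ∷ us) × (Adj G w y × y ∈ˡ v ∷ us)
cycle-neighbours G {v} {x ∷ x′ ∷ us} (le , _ ∷ u , links) (here refl) with snoc-view x′ us
... | ys , y , eq =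
  x , y , (λ { refl → Unique[x∷xs]⇒x∉xs u y∈ }) ,
  (Linked.head links , there (here refl)) ,
  (Graph.sym G (linked-++⁻ (v ∷ x ∷ ys) (subst (λ ws → Linked (Adj G) (v ∷ x ∷ ws)) eq′ links)) , there (there y∈))
  where
  y∈ : y ∈ˡ x′ ∷ us
  y∈ = subst (y ∈ˡ_) (sym eq) (∈-++⁺ʳ ys (here refl))
  eq′ : (x′ ∷ us) ∷ʳ v ≡ ys ++ y ∷ v ∷ []
  eq′ = trans (cong (_∷ʳ v) eq) (++-assoc ys (y ∷ []) _)
cycle-neighbours G {us = x ∷ []} (s≤s () , _) (here refl)
cycle-neighbours G {us = []} (() , _) (here refl)
cycle-neighbours G {v} {us} {w} (le , u , links) (there w∈us) with ∈-∃++ w∈us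
... | xs , y ∷ ys , refl with snoc-view v xs
...   | ps , p , eq =
  p , y , (λ { refl → unique-++⁻ (v ∷ xs) u p∈ (there (here refl)) }) ,
  (Graph.sym G (linked-++⁻ ps (subst (Linked (Adj G)) eq′ links)) , ∈-++⁺ˡ p∈) ,
  (linked-++⁻ (v ∷ xs) (subst (λ ws → Linked (Adj G) (v ∷ ws)) (++-assoc xs _ _) links) ,
    ∈-++⁺ʳ (v ∷ xs) (there (here refl)))
  where
  p∈ : p ∈ˡ v ∷ xs
  p∈ = subst (p ∈ˡ_) (sym eq) (∈-++⁺ʳ ps (here refl))
  eq′ : v ∷ (xs ++ w ∷ y ∷ ys) ∷ʳ v ≡ ps ++ p ∷ w ∷ (y ∷ ys) ∷ʳ v
  eq′ = trans (cong (v ∷_) (++-assoc xs _ _))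
        (trans (cong (_++ w ∷ (y ∷ ys) ∷ʳ v) eq) (++-assoc ps (p ∷ []) _))
cycle-neighbours G (s≤s () , u , links) (there w∈us) | [] , [] , refl
cycle-neighbours G {v} {us} {w} (le , u , links) (there w∈us) | x ∷ xs , [] , refl with snoc-view x xs
... | ps , p , eq =
  p , v , (λ { refl → Unique[x∷xs]⇒x∉xs u (∈-++⁺ˡ p∈) }) ,
  (Graph.sym G (linked-++⁻ (v ∷ ps) (subst (λ ws → Linked (Adj G) (v ∷ ws)) eq′ links)) , there (∈-++⁺ˡ p∈)) ,
  (linked-++⁻ (v ∷ x ∷ xs) (subst (λ ws → Linked (Adj G) (v ∷ ws)) (++-assoc (x ∷ xs) _ _) links) , here refl)
  where
  p∈ : p ∈ˡ x ∷ xs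
  p∈ = subst (p ∈ˡ_) (sym eq) (∈-++⁺ʳ ps (here refl))
  eq′ : ((x ∷ xs) ++ w ∷ []) ∷ʳ v ≡ ps ++ p ∷ w ∷ v ∷ []
  eq′ = trans (++-assoc (x ∷ xs) _ _) (trans (cong (_++ w ∷ v ∷ []) eq) (++-assoc ps (p ∷ []) _))

-- Colourings, trails and the cycles they close

data Colour : Set where
  blank inA inB : Colour

paint : ∀ {n} → (Fin n → Colour) → Fin n → Colour → Fin n → Colour
paint col v c u = if does (u ≟ᶠ v) then c else col u

paint-≡ : ∀ {n} (col : Fin n → Colour) v c → paint col v c v ≡ c
paint-≡ col v c with v ≟ᶠ v
... | yes _  = refl
... | no v≢v = contradiction refl v≢v

paint-≢ : ∀ {n} (col : Fin n → Colour) {v u} c → u ≢ v → paint col v c u ≡ col u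
paint-≢ col {v} {u} c u≢v with u ≟ᶠ v
... | yes u≡v = contradiction u≡v u≢v
... | no _    = refl

module Walks {n : ℕ} (G : Graph (Fin n)) where

  infix 4 _~_
  _~_ : Fin n → Fin n → Set
  _~_ = Adj G

  ~-sym : ∀ {u v} → u ~ v → v ~ u
  ~-sym = Graph.sym G

  ~⇒≢ : ∀ {u v} → u ~ v → u ≢ v
  ~⇒≢ u~v u≡v = Graph.irrefl G u≡v u~v

  module _ (col : Fin n → Colour) where

    Independent Acyclic : Set
    Independent = ∀ {u v} → col u ≡ inA → col v ≡ inA → ¬ u ~ v
    Acyclic     = ∀ {v us} → IsCycle G v us → ¬ All (λ u → col u ≡ inB) (v ∷ us)

    -- The safety invariant of a walk: B may contain cycles, but taking `w` out of it destroys them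
    -- all.
    CyclesThrough : Fin n → Set
    CyclesThrough w = ∀ {v us} → IsCycle G v us → All (λ u → col u ≡ inB) (v ∷ us) → w ∈ˡ v ∷ us

    -- The only situation in which a walk goes on. By `only` there is no uncoloured neighbour. The
    -- order of `b₁` and `b₂` is a choice of direction: the walk continues to `b₁`.
    record Turn (w : Fin n) : Set where
      field
        {a b₁ b₂} : Fin n
        w~a   : w ~ a
        w~b₁  : w ~ b₁
        w~b₂  : w ~ b₂
        a-inA : col a ≡ inA
        b₁-inB : col b₁ ≡ inB
        b₂-inB : col b₂ ≡ inB
        b₁≢b₂ : b₁ ≢ b₂
        only  : ∀ {x} → w ~ x → x ≡ a ⊎ x ≡ b₁ ⊎ x ≡ b₂

      onlyA : ∀ {x} → w ~ x → col x ≡ inA → x ≡ a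
      onlyA w~x x-inA with only w~x
      ... | inj₁ x≡a          = x≡a
      ... | inj₂ (inj₁ refl)  = contradiction (trans (sym x-inA) b₁-inB) λ ()
      ... | inj₂ (inj₂ refl)  = contradiction (trans (sym x-inA) b₂-inB) λ ()

      onlyB : ∀ {x} → w ~ x → col x ≡ inB → x ≡ b₁ ⊎ x ≡ b₂
      onlyB w~x x-inB with only w~x
      ... | inj₁ refl = contradiction (trans (sym x-inB) a-inA) λ ()
      ... | inj₂ x≡b  = x≡b

      not-blank : ∀ {x} → w ~ x → col x ≢ blank
      not-blank w~x x-blank with only w~x
      ... | inj₁ refl        = contradiction (trans (sym x-blank) a-inA) λ ()
      ... | inj₂ (inj₁ refl) = contradiction (trans (sym x-blank) b₁-inB) λ ()
      ... | inj₂ (inj₂ refl) = contradiction (trans (sym x-blank) b₂-inB) λ ()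

  open Turn public

  A≢B : ∀ {c : Colour} → c ≡ inA → c ≢ inB
  A≢B refl ()

  unpaint : ∀ (col : Fin n → Colour) v u {c d} → c ≢ d → paint col v c u ≡ d → u ≢ v × col u ≡ d
  unpaint col v u c≢d eq with u ≟ᶠ v
  ... | yes refl = contradiction eq c≢d
  ... | no u≢v   = u≢v , eq

  paint-id : ∀ (col : Fin n → Colour) v u {c} → col u ≡ c → paint col v c u ≡ c
  paint-id col v u eq with u ≟ᶠ v
  ... | yes _ = refl
  ... | no  _ = eq

  module _ {col : Fin n → Colour} {w : Fin n} where

    -- A cycle of B through `w` would supply two distinct B-neighbours of `w`.
    through⇒acyclic : CyclesThrough col w →
      (∀ {x y} → w ~ x → w ~ y → col x ≡ inB → col y ≡ inB → x ≡ y) → Acyclic col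
    through⇒acyclic thr one cyc all with cycle-neighbours G cyc (thr cyc all)
    ... | x , y , x≢y , (w~x , x∈) , (w~y , y∈) = x≢y (one w~x w~y (All.lookup all x∈) (All.lookup all y∈))

    paintA-acyclic : CyclesThrough col w → Acyclic (paint col w inA)
    paintA-acyclic thr cyc all =
      proj₁ (unpaint col w w (λ ()) (All.lookup all (thr cyc
        (All.map (λ {u} → proj₂ ∘ unpaint col w u λ ()) all)))) refl

    -- A cycle of B that misses `w` was already there before `w` was recoloured.
    paintB-through : Acyclic col → CyclesThrough (paint col w inB) w
    paintB-through acyc {v} {us} cyc all with _∈?_ _≟ᶠ_ w (v ∷ us)
    ... | yes w∈ = w∈
    ... | no w∉  = contradiction
      (All.tabulate λ {u} u∈ → trans (sym (paint-≢ col inB λ { refl → w∉ u∈ })) (All.lookup all u∈)) (acyc cyc)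

    -- A cycle uses two B-neighbours of `w`, and `w` has only `b₁` and `b₂`.
    through-b₁ : (t : Turn col w) → CyclesThrough col w → CyclesThrough col (b₁ t)
    through-b₁ t thr cyc all with cycle-neighbours G cyc (thr cyc all)
    ... | x , y , x≢y , (w~x , x∈) , (w~y , y∈) with onlyB t w~x (All.lookup all x∈) | onlyB t w~y (All.lookup all y∈)
    ...   | inj₁ refl | _         = x∈
    ...   | inj₂ refl | inj₁ refl = y∈
    ...   | inj₂ refl | inj₂ refl = contradiction refl x≢y

    paintA-independent : Independent col → (∀ {x} → w ~ x → col x ≢ inA) → Independent (paint col w inA)
    paintA-independent ind none {u} {v} u-inA v-inA u~v with u ≟ᶠ w | v ≟ᶠ w
    ... | yes refl | yes refl = ~⇒≢ u~v refl
    ... | yes refl | no _     = none u~v v-inA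
    ... | no _     | yes refl = none (~-sym u~v) u-inA
    ... | no _     | no _     = ind u-inA v-inA u~v

    paintB-independent : Independent col → Independent (paint col w inB)
    paintB-independent ind {u} {v} u-inA v-inA =
      ind (proj₂ (unpaint col w u (λ ()) u-inA)) (proj₂ (unpaint col w v (λ ()) v-inA))

    -- The one A-neighbour of `w` leaves A as `w` enters it.
    swap-independent : (t : Turn col w) → Independent col → Independent (paint (paint col w inA) (a t) inB)
    swap-independent t ind {u} {v} u-inA v-inA u~v
      with unpaint (paint col w inA) (a t) u (λ ()) u-inA | unpaint (paint col w inA) (a t) v (λ ()) v-inA
    ... | u≢a , u-inA′ | v≢a , v-inA′ with u ≟ᶠ w | v ≟ᶠ w
    ...   | yes refl | yes refl = ~⇒≢ u~v refl
    ...   | yes refl | no _     = v≢a (onlyA t u~v v-inA′)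
    ...   | no _     | yes refl = u≢a (onlyA t (~-sym u~v) u-inA′)
    ...   | no _     | no _     = ind u-inA′ v-inA′ u~v

  -- A closed walk in local form, with the order of travel forgotten: each vertex has both its
  -- B-neighbours in `T`, so `T` is a union of components of B.
  Tour : (Fin n → Colour) → List (Fin n) → Set
  Tour col T = ∀ {u} → u ∈ˡ T → Σ (Turn col u) λ t → b₁ t ∈ˡ T × b₂ t ∈ˡ T

  tour-closed : ∀ {col T u x} → Tour col T → u ∈ˡ T → u ~ x → col x ≡ inB → x ∈ˡ T
  tour-closed tour u∈ u~x x-inB with tour u∈
  ... | t , b₁∈ , b₂∈ with onlyB t u~x x-inB
  ...   | inj₁ refl = b₁∈
  ...   | inj₂ refl = b₂∈

  -- T is what has been walked since h became the hole, w the current and p the previous vertex.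
  record Trail (col : Fin n → Colour) (h w p : Fin n) (T : List (Fin n)) : Set where
    field
      w∈T      : w ∈ˡ T
      h∈T      : h ∈ˡ T
      distinct : Unique T
      inB-T    : ∀ {u} → u ∈ˡ T → col u ≡ inB
      -- The last clause says that the tip `w` has no chord back into the trail; it makes the next
      -- vertex new.
      inner    : ∀ {u} → u ∈ˡ T → u ≢ w → u ≢ h →
                 Σ (Turn col u) λ t → b₁ t ∈ˡ T × b₂ t ∈ˡ T × (u ~ w → u ≡ p)
      -- The implication excludes closing by a step straight back: if `w` is where the trail went
      -- first, then the previous vertex is the hole.
      outer    : w ≢ h → Σ (Turn col h) λ t → b₁ t ∈ˡ T × (b₁ t ≡ w → p ≡ h)
      previous : w ≢ h → p ∈ˡ T × w ~ p
      alone    : w ≡ h → ∀ {u} → u ∈ˡ T → u ≡ h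

  trail-start : ∀ {col h p} → col h ≡ inB → Trail col h h p [ h ]
  trail-start h-inB = record
    { w∈T      = here refl
    ; h∈T      = here refl
    ; distinct = [] ∷ []
    ; inB-T    = λ { (here refl) → h-inB }
    ; inner    = λ { (here refl) u≢h → contradiction refl u≢h }
    ; outer    = λ h≢h → contradiction refl h≢h
    ; previous = λ h≢h → contradiction refl h≢h
    ; alone    = λ { _ (here eq) → eq }
    }

  module _ {col : Fin n → Colour} {h w p : Fin n} {T : List (Fin n)}
           (tr : Trail col h w p T) (t : Turn col w) (b₁≢p : b₁ t ≢ p) where
    open Trail tr

    previous-b₂ : w ≢ h → p ≡ b₂ t
    previous-b₂ w≢h with previous w≢h
    ... | p∈T , w~p with onlyB t w~p (inB-T p∈T)
    ...   | inj₁ p≡b₁ = contradiction (sym p≡b₁) b₁≢p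
    ...   | inj₂ p≡b₂ = p≡b₂

    -- Away from the hole, a trail vertex adjacent to `w` can only be `p`, by the chord clause of
    -- `inner`.
    trail-fresh : b₁ t ≢ h → b₁ t ∉ˡ T
    trail-fresh b₁≢h b₁∈T with w ≟ᶠ h
    ... | yes w≡h = b₁≢h (alone w≡h b₁∈T)
    ... | no  _   = b₁≢p (proj₂ (proj₂ (proj₂ (inner b₁∈T (~⇒≢ (~-sym (w~b₁ t))) b₁≢h))) (~-sym (w~b₁ t)))

    trail-move : b₁ t ≢ h → Trail col h (b₁ t) w (b₁ t ∷ T)
    trail-move b₁≢h = record
      { w∈T      = here refl
      ; h∈T      = there h∈T
      ; distinct = ¬Any⇒All¬ T fresh ∷ distinct
      ; inB-T    = λ { (here refl) → b₁-inB t ; (there u∈) → inB-T u∈ }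
      ; inner    = inner′
      ; outer    = λ _ → outer′
      ; previous = λ _ → there w∈T , ~-sym (w~b₁ t)
      ; alone    = λ b₁≡h → contradiction b₁≡h b₁≢h
      }
      where
      fresh = trail-fresh b₁≢h
      inner′ : ∀ {u} → u ∈ˡ b₁ t ∷ T → u ≢ b₁ t → u ≢ h →
        Σ (Turn col u) λ t′ → b₁ t′ ∈ˡ b₁ t ∷ T × b₂ t′ ∈ˡ b₁ t ∷ T × (u ~ b₁ t → u ≡ w)
      inner′ (here u≡b₁) u≢b₁ _ = contradiction u≡b₁ u≢b₁
      inner′ {u} (there u∈) u≢b₁ u≢h with u ≟ᶠ w
      ... | yes refl = t , here refl , there (subst (_∈ˡ T) (previous-b₂ u≢h) (proj₁ (previous u≢h))) , λ _ → refl
      ... | no u≢w with inner u∈ u≢w u≢h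
      ...   | t′ , b₁∈ , b₂∈ , _ = t′ , there b₁∈ , there b₂∈ , λ u~b₁ → contradiction (next∈ u~b₁) fresh
        where
        next∈ : u ~ b₁ t → b₁ t ∈ˡ T
        next∈ u~b₁ with onlyB t′ u~b₁ (b₁-inB t)
        ... | inj₁ eq = subst (_∈ˡ T) (sym eq) b₁∈
        ... | inj₂ eq = subst (_∈ˡ T) (sym eq) b₂∈
      outer′ : Σ (Turn col h) λ t′ → b₁ t′ ∈ˡ b₁ t ∷ T × (b₁ t′ ≡ b₁ t → w ≡ h)
      outer′ with w ≟ᶠ h
      ... | yes refl = t , here refl , λ _ → refl
      ... | no w≢h with outer w≢h
      ...   | t′ , b₁∈ , _ = t′ , there b₁∈ , λ eq → contradiction (subst (_∈ˡ T) eq b₁∈) fresh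

    -- Only the hole needs an argument, since so far just its outgoing neighbour is known to lie in
    -- `T`. The other one is `w`: were `w` the outgoing neighbour, `p` would be the hole, against
    -- `b₁≢p`.
    trail-close : b₁ t ≡ h → Tour col T
    trail-close b₁≡h {u} u∈ with u ≟ᶠ w | u ≟ᶠ h
    ... | yes refl | yes refl = contradiction (sym b₁≡h) (~⇒≢ (w~b₁ t))
    ... | yes refl | no u≢h   =
        t , subst (_∈ˡ T) (sym b₁≡h) h∈T , subst (_∈ˡ T) (previous-b₂ u≢h) (proj₁ (previous u≢h))
    ... | no u≢w   | no u≢h with inner u∈ u≢w u≢h
    ...   | t′ , b₁∈ , b₂∈ , _ = t′ , b₁∈ , b₂∈
    trail-close b₁≡h {u} u∈ | no u≢w | yes refl with outer (u≢w ∘ sym)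
    ...   | t′ , b₁∈ , first = t′ , b₁∈ , last
      where
      last : b₂ t′ ∈ˡ T
      last with onlyB t′ (~-sym (subst (w ~_) b₁≡h (w~b₁ t))) (inB-T w∈T)
      ... | inj₁ w≡b₁ = contradiction (trans b₁≡h (sym (first (sym w≡b₁)))) b₁≢p
      ... | inj₂ w≡b₂ = subst (_∈ˡ T) w≡b₂ w∈T

  three-among-two : ∀ {p q x y z : Fin n} → x ≡ p ⊎ x ≡ q → y ≡ p ⊎ y ≡ q → x ≢ y → x ≢ z → y ≢ z → ¬ (z ≡ p ⊎ z ≡ q)
  three-among-two (inj₁ refl) (inj₁ refl) x≢y _   _   _           = x≢y refl
  three-among-two (inj₂ refl) (inj₂ refl) x≢y _   _   _           = x≢y refl
  three-among-two (inj₁ refl) _           _   x≢z _   (inj₁ refl) = x≢z refl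
  three-among-two (inj₂ refl) _           _   x≢z _   (inj₂ refl) = x≢z refl
  three-among-two _           (inj₁ refl) _   _   y≢z (inj₁ refl) = y≢z refl
  three-among-two _           (inj₂ refl) _   _   y≢z (inj₂ refl) = y≢z refl

  -- A cycle C closed by an earlier walk: its gate was moved to A, the rest of it stays in B,
  -- and the only B-neighbour the rest can have outside C is the present hole h.  V is the
  -- union of all such cycles.
  record Entry (col : Fin n → Colour) (h : Fin n) (V C : List (Fin n)) : Set where
    field
      {gate}  : Fin n
      gate∈   : gate ∈ˡ C
      gate-A  : col gate ≡ inA
      rest-B  : ∀ {u} → u ∈ˡ C → u ≢ gate → col u ≡ inB
      two     : ∀ {u} → u ∈ˡ C → ∃₂ λ x y → x ≢ y × (u ~ x × x ∈ˡ C) × (u ~ y × y ∈ˡ C)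
      sealed  : ∀ {u x} → u ∈ˡ C → col u ≡ inB → u ~ x → col x ≡ inB → x ∈ˡ C ⊎ x ≡ h
      guarded : ∀ {x} → gate ~ x → x ∈ˡ V ⊎ x ≡ h

    inA⇒gate : ∀ {u} → u ∈ˡ C → col u ≡ inA → u ≡ gate
    inA⇒gate {u} u∈ u-inA with u ≟ᶠ gate
    ... | yes u≡g = u≡g
    ... | no  u≢g = contradiction (rest-B u∈ u≢g) (A≢B u-inA)

    -- A vertex of C whose B-neighbour h lies outside C keeps two neighbours in C, one of which must be in A.
    exit⇒gate : h ∉ˡ C → ∀ {u} → u ∈ˡ C → (t : Turn col u) → u ~ h → col h ≡ inB → a t ≡ gate
    exit⇒gate h∉C u∈ t u~h h-inB with two u∈
    ... | x , y , x≢y , (u~x , x∈) , (u~y , y∈) with only t u~x | only t u~y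
    ...   | inj₁ refl | _         = inA⇒gate x∈ (a-inA t)
    ...   | inj₂ _    | inj₁ refl = inA⇒gate y∈ (a-inA t)
    ...   | inj₂ x-b  | inj₂ y-b  = contradiction (onlyB t u~h h-inB)
            (three-among-two x-b y-b x≢y (λ { refl → h∉C x∈ }) (λ { refl → h∉C y∈ }))

  data Side (h : Fin n) (es : List (List (Fin n))) (T : List (Fin n)) : Set where
    avoids : (∀ {u} → u ∈ˡ T → u ∉ˡ concat es) → Side h es T
    within : ∀ {C} → C ∈ˡ es → (∀ {u} → u ∈ˡ T → u ≢ h → u ∈ˡ C) → Side h es T

  record Fresh (col : Fin n → Colour) (h : Fin n) (es : List (List (Fin n))) (T : List (Fin n)) : Set where
    field
      entry : ∀ {C} → C ∈ˡ es → Entry col h (concat es) C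
      once  : Unique (concat es)
      h∉    : h ∉ˡ concat es
      side  : Side h es T

  fresh-start : ∀ {col h T} → Fresh col h [] T
  fresh-start = record { entry = λ () ; once = [] ; h∉ = λ () ; side = avoids λ _ () }

  K₄-free : Set
  K₄-free = ∀ {b c d e} → b ~ c → b ~ d → b ~ e → c ~ d → c ~ e → ¬ d ~ e

  swapped : (Fin n → Colour) → Fin n → Fin n → Fin n → Colour
  swapped col w c = paint (paint col w inA) c inB

  module _ {col : Fin n → Colour} {h w p : Fin n} {T : List (Fin n)} {es : List (List (Fin n))}
           (tr : Trail col h w p T) (fr : Fresh col h es T) (t : Turn col w) (b₁≢p : b₁ t ≢ p) where
    open Trail tr
    open Fresh fr
    open Entry

    w-inB : col w ≡ inB
    w-inB = inB-T w∈T

    -- By `sealed`, an old cycle is entered only from the hole, hence only by the first step of a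
    -- trail, and it is left only into the hole.
    fresh-move : b₁ t ≢ h → Fresh col h es (b₁ t ∷ T)
    fresh-move b₁≢h = record { entry = entry ; once = once ; h∉ = h∉ ; side = move side }
      where
      move : Side h es T → Side h es (b₁ t ∷ T)
      move (within C∈ T⊆) with w ≟ᶠ h
      ... | no w≢h with sealed (entry C∈) (T⊆ w∈T w≢h) w-inB (w~b₁ t) (b₁-inB t)
      ...   | inj₁ b₁∈ = within C∈ λ { (here refl) _ → b₁∈ ; (there u∈) → T⊆ u∈ }
      ...   | inj₂ b₁≡h = contradiction b₁≡h b₁≢h
      move (within C∈ T⊆) | yes w≡h = start w≡h
        where
        start : w ≡ h → Side h es (b₁ t ∷ T)
        start w≡h with _∈?_ _≟ᶠ_ (b₁ t) (concat es)
        ... | no b₁∉ = avoids λ { (here refl) → b₁∉ ; (there u∈) u∈V → h∉ (subst (_∈ˡ concat es) (alone w≡h u∈) u∈V) }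
        ... | yes b₁∈ with ∈-concat⁻′ es b₁∈
        ...   | C , b₁∈C , C∈es =
            within C∈es λ { (here refl) _ → b₁∈C ; (there u∈) u≢h → contradiction (alone w≡h u∈) u≢h }
      move (avoids T∉) with _∈?_ _≟ᶠ_ (b₁ t) (concat es)
      ... | no b₁∉ = avoids λ { (here refl) → b₁∉ ; (there u∈) → T∉ u∈ }
      ... | yes b₁∈ with ∈-concat⁻′ es b₁∈
      ...   | C , b₁∈C , C∈es with sealed (entry C∈es) b₁∈C (b₁-inB t) (~-sym (w~b₁ t)) w-inB
      ...     | inj₁ w∈C = contradiction (∈-concat⁺′ w∈C C∈es) (T∉ w∈T)
      ...     | inj₂ w≡h = within C∈es λ { (here refl) _ → b₁∈C ; (there u∈) u≢h → contradiction (alone w≡h u∈) u≢h }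

    module _ (b₁≡h : b₁ t ≡ h) where
      private
        col′ : Fin n → Colour
        col′ = swapped col w (a t)

        tour : Tour col T
        tour = trail-close tr t b₁≢p b₁≡h

        w~h : w ~ h
        w~h = subst (w ~_) b₁≡h (w~b₁ t)

        w≢h : w ≢ h
        w≢h = ~⇒≢ w~h

        a≢w : a t ≢ w
        a≢w = ~⇒≢ (~-sym (w~a t))

        w-inA′ : col′ w ≡ inA
        w-inA′ = trans (paint-≢ (paint col w inA) inB (a≢w ∘ sym)) (paint-≡ col w inA)

        keep : ∀ {u} → u ≢ w → u ≢ a t → col′ u ≡ col u
        keep u≢w u≢a = trans (paint-≢ (paint col w inA) inB u≢a) (paint-≢ col inA u≢w)

        keepB : ∀ {u} → u ≢ w → col u ≡ inB → col′ u ≡ inB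
        keepB {u} u≢w u-inB = paint-id (paint col w inA) (a t) u (trans (paint-≢ col inA u≢w) u-inB)

        inB′ : ∀ {u} → col′ u ≡ inB → u ≡ a t ⊎ (u ≢ w × col u ≡ inB)
        inB′ {u} u-inB with u ≟ᶠ a t
        ... | yes u≡a = inj₁ u≡a
        ... | no  u≢a = inj₂ (unpaint col w u (λ ()) u-inB)

      -- The trail joins the old cycles with `w` as its gate, and `a t` is the new hole. The earlier
      -- cycles stay sealed although the hole has moved: a B-vertex of theirs next to the old hole
      -- would be a B-neighbour of the tour and so lie on it.
      close-avoiding : (∀ {u} → u ∈ˡ T → u ∉ˡ concat es) → Fresh col′ (a t) (T ∷ es) [ a t ]
      close-avoiding T∉ = record
        { entry = λ { (here refl) → newest ; (there C∈) → older C∈ }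
        ; once  = unique-++⁺ distinct once λ (u∈T , u∈V) → T∉ u∈T u∈V
        ; h∉    = a∉
        ; side  = avoids λ { (here refl) → a∉ }
        }
        where
        V′ = concat (T ∷ es)
        newest : Entry col′ (a t) V′ T
        newest = record
          { gate∈   = w∈T
          ; gate-A  = w-inA′
          ; rest-B  = λ u∈ u≢w → keepB u≢w (inB-T u∈)
          ; two     = two-T
          ; sealed  = λ u∈ _ u~x x-inB → sealed-T u∈ u~x (inB′ x-inB)
          ; guarded = λ w~x → guarded-T (only t w~x)
          }
          where
          two-T : ∀ {u} → u ∈ˡ T → ∃₂ λ x y → x ≢ y × (u ~ x × x ∈ˡ T) × (u ~ y × y ∈ˡ T)
          two-T u∈ with tour u∈
          ... | t′ , b₁∈ , b₂∈ = b₁ t′ , b₂ t′ , b₁≢b₂ t′ , (w~b₁ t′ , b₁∈) , (w~b₂ t′ , b₂∈)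
          sealed-T : ∀ {u x} → u ∈ˡ T → u ~ x → x ≡ a t ⊎ (x ≢ w × col x ≡ inB) → x ∈ˡ T ⊎ x ≡ a t
          sealed-T u∈ u~x (inj₁ x≡a)         = inj₂ x≡a
          sealed-T u∈ u~x (inj₂ (_ , x-inB)) = inj₁ (tour-closed tour u∈ u~x x-inB)
          guarded-T : ∀ {x} → x ≡ a t ⊎ x ≡ b₁ t ⊎ x ≡ b₂ t → x ∈ˡ V′ ⊎ x ≡ a t
          guarded-T (inj₁ x≡a)         = inj₂ x≡a
          guarded-T (inj₂ (inj₁ refl)) = inj₁ (∈-++⁺ˡ (tour-closed tour w∈T (w~b₁ t) (b₁-inB t)))
          guarded-T (inj₂ (inj₂ refl)) = inj₁ (∈-++⁺ˡ (tour-closed tour w∈T (w~b₂ t) (b₂-inB t)))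

        -- An A-vertex on an old cycle is its gate, whose neighbours lie on old cycles or are the
        -- hole; `w` does neither.
        a∉es : ∀ {C} → C ∈ˡ es → a t ∉ˡ C
        a∉es C∈ a∈ with guarded (entry C∈) (subst (_~ w) (inA⇒gate (entry C∈) a∈ (a-inA t)) (~-sym (w~a t)))
        ... | inj₁ w∈V = T∉ w∈T w∈V
        ... | inj₂ w≡h = w≢h w≡h
        a∉ : a t ∉ˡ V′
        a∉ a∈ with ∈-++⁻ T a∈
        ... | inj₁ a∈T = A≢B (a-inA t) (inB-T a∈T)
        ... | inj₂ a∈V with ∈-concat⁻′ es a∈V
        ...   | C , a∈C , C∈ = a∉es C∈ a∈C

        older : ∀ {C} → C ∈ˡ es → Entry col′ (a t) V′ C
        older {C} C∈ = record
          { gate∈   = gate∈ e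
          ; gate-A  = trans (keep (≢w (gate∈ e)) (≢a (gate∈ e))) (gate-A e)
          ; rest-B  = λ u∈ u≢g → trans (keep (≢w u∈) (≢a u∈)) (rest-B e u∈ u≢g)
          ; two     = two e
          ; sealed  = λ u∈ u-inB u~x x-inB → sealed-C u∈ (trans (sym (keep (≢w u∈) (≢a u∈))) u-inB) u~x (inB′ x-inB)
          ; guarded = λ g~x → guarded-C (guarded e g~x)
          }
          where
          e : Entry col h (concat es) C
          e = entry C∈
          ≢w : ∀ {u} → u ∈ˡ C → u ≢ w
          ≢w u∈ refl = T∉ w∈T (∈-concat⁺′ u∈ C∈)
          ≢a : ∀ {u} → u ∈ˡ C → u ≢ a t
          ≢a u∈ refl = a∉es C∈ u∈
          sealed-C : ∀ {u x} → u ∈ˡ C → col u ≡ inB → u ~ x → x ≡ a t ⊎ (x ≢ w × col x ≡ inB) → x ∈ˡ C ⊎ x ≡ a t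
          sealed-C u∈ u-inB u~x (inj₁ x≡a) = inj₂ x≡a
          sealed-C u∈ u-inB u~x (inj₂ (_ , x-inB)) with sealed e u∈ u-inB u~x x-inB
          ... | inj₁ x∈   = inj₁ x∈
          ... | inj₂ refl = contradiction (∈-concat⁺′ u∈ C∈) (T∉ (tour-closed tour h∈T (~-sym u~x) u-inB))
          guarded-C : ∀ {x} → x ∈ˡ concat es ⊎ x ≡ h → x ∈ˡ V′ ⊎ x ≡ a t
          guarded-C (inj₁ x∈V)  = inj₁ (∈-++⁺ʳ T x∈V)
          guarded-C (inj₂ refl) = inj₁ (∈-++⁺ˡ h∈T)

      -- Closing a trail on an old cycle C leaves the gate of C as the hole.  It and the three
      -- vertices h, w and b, where w and b are the neighbours of h on C, form a K₄ if the
      -- next trail closes again.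
      close-within : ∀ {C} → C ∈ˡ es → (∀ {u} → u ∈ˡ T → u ≢ h → u ∈ˡ C) →
        K₄-free →
        ∀ {T′} → a t ∈ˡ T′ → ¬ Tour col′ T′
      close-within {C} C∈ T⊆ no-K₄ {T′} a∈T′ tour′ = other (onlyB th (~-sym w~h) w-inB)
        where
        e : Entry col h (concat es) C
        e = entry C∈
        c = gate e
        h-inB : col h ≡ inB
        h-inB = inB-T h∈T
        h∉C : h ∉ˡ C
        h∉C h∈C = h∉ (∈-concat⁺′ h∈C C∈)
        th = proj₁ (tour h∈T)
        a≡c : a t ≡ c
        a≡c = exit⇒gate e h∉C (T⊆ w∈T w≢h) t w~h h-inB
        h-inB′ : col′ h ≡ inB
        h-inB′ = keepB (w≢h ∘ sym) h-inB
        conclude : ∀ {b} → h ~ b → col b ≡ inB → b ∈ˡ T → b ≢ w → _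
        conclude {b} h~b b-inB b∈T b≢w = no-K₄ b~a b~w (~-sym h~b) (~-sym (w~a t)) (~-sym h~a) w~h
          where
          tb = proj₁ (tour b∈T)
          atb≡a : a tb ≡ a t
          atb≡a = trans (exit⇒gate e h∉C (T⊆ b∈T (~⇒≢ (~-sym h~b))) tb (~-sym h~b) h-inB) (sym a≡c)
          b~a : b ~ a t
          b~a = subst (b ~_) atb≡a (w~a tb)
          b∈T′ : b ∈ˡ T′
          b∈T′ = tour-closed tour′ a∈T′ (~-sym b~a) (keepB b≢w b-inB)
          t₂ = proj₁ (tour′ b∈T′)
          h∈T′ : h ∈ˡ T′
          h∈T′ = tour-closed tour′ b∈T′ (~-sym h~b) h-inB′
          t₃ = proj₁ (tour′ h∈T′)
          inA′ : ∀ {u} → col′ u ≡ inA → u ≡ w ⊎ (u ≢ a t × col u ≡ inA)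
          inA′ {u} u-inA with unpaint (paint col w inA) (a t) u (λ ()) u-inA
          ... | u≢a , u-inA′ with u ≟ᶠ w
          ...   | yes u≡w = inj₁ u≡w
          ...   | no  u≢w = inj₂ (u≢a , u-inA′)
          -- After the swap `b` still has an A-neighbour. Its only earlier one was the gate, which
          -- is now in B, so it must be `w`.
          b~w : b ~ w
          b~w with inA′ (a-inA t₂)
          ... | inj₁ eq = subst (b ~_) eq (w~a t₂)
          ... | inj₂ (≢a , A) = contradiction (trans (onlyA tb (w~a t₂) A) atb≡a) ≢a
          -- If the earlier A-neighbour of `h` were not the gate, it would still be in A, next to
          -- `w`, and `h` would have two A-neighbours on a tour.
          h~a : h ~ a t
          h~a with a th ≟ᶠ a t
          ... | yes eq = subst (h ~_) eq (w~a th)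
          ... | no ≢a =
              contradiction (trans (onlyA t₃ (w~a th) (trans (keep th≢w ≢a) (a-inA th)))
                  (sym (onlyA t₃ (~-sym w~h) w-inA′))) th≢w
            where
            th≢w : a th ≢ w
            th≢w eq = A≢B (a-inA th) (trans (cong col eq) w-inB)
        other : w ≡ b₁ th ⊎ w ≡ b₂ th → _
        other (inj₁ eq) =
            conclude (w~b₂ th) (b₂-inB th) (proj₂ (proj₂ (tour h∈T))) λ eq′ → b₁≢b₂ th (sym (trans eq′ eq))
        other (inj₂ eq) = conclude (w~b₁ th) (b₁-inB th) (proj₁ (proj₂ (tour h∈T))) λ eq′ → b₁≢b₂ th (trans eq′ eq)

-- The process as a transition system, and its step count

module Phases {n : ℕ} {G : Graph (Fin n)} (L : AdjacencyLists G) (subcubic : Subcubic G) where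
  open Search L subcubic using (Closed; SearchOrder; []; _∷_)
  open Walks G

  -- In walking col h w p r every cycle of B passes through w: the hole h was put in B last, the
  -- walk has come from h to w along B, p is the vertex before w, and r is still to be coloured.
  data Phase : Set where
    idle    : (Fin n → Colour) → List (Fin n) → Phase
    walking : (Fin n → Colour) → (h w p : Fin n) → List (Fin n) → Phase

  data _⟶_ : Phase → Phase → Set where
    -- With `p` set to `x` itself, `b₁ t ≢ p` holds for either direction; after `close` it does so
    -- again, as `p` is then in A.
    begin : ∀ {col x r} → idle col (x ∷ r) ⟶ walking (paint col x inB) x x x r
    lift  : ∀ {col h w p r} → (∀ {x} → w ~ x → col x ≢ inA) → walking col h w p r ⟶ idle (paint col w inA) r
    leaf  : ∀ {col h w p r} → (∀ {x y} → w ~ x → w ~ y → col x ≡ inB → col y ≡ inB → x ≡ y) →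
            walking col h w p r ⟶ idle col r
    move  : ∀ {col h w p r} (t : Turn col w) → b₁ t ≢ p → b₁ t ≢ h → walking col h w p r ⟶ walking col h (b₁ t) w r
    close : ∀ {col h w p r} (t : Turn col w) → b₁ t ≢ p → b₁ t ≡ h →
            walking col h w p r ⟶ walking (swapped col w (a t)) (a t) (a t) w r

  record Pending (col : Fin n → Colour) (r : List (Fin n)) : Set where
    field
      blanks   : ∀ {y} → y ∈ˡ r → col y ≡ blank
      covers   : ∀ u → u ∈ˡ r ⊎ col u ≢ blank
      distinct : Unique r
      ordered  : SearchOrder r

  open Pending

  paint-pending : ∀ {col r c} v → Pending col r → col v ≢ blank → c ≢ blank → Pending (paint col v c) r
  paint-pending {col} {r} {c} v P v≢ c≢ = record
    { blanks   = λ {y} y∈ → trans (paint-≢ col c λ { refl → v≢ (blanks P y∈) }) (blanks P y∈)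
    ; covers   = covers′
    ; distinct = distinct P
    ; ordered  = ordered P
    }
    where
    covers′ : ∀ u → u ∈ˡ r ⊎ paint col v c u ≢ blank
    covers′ u with u ≟ᶠ v
    ... | yes _ = inj₂ c≢
    ... | no  _ = covers P u

  inA≢blank : ∀ {c : Colour} → c ≡ inA → c ≢ blank
  inA≢blank refl ()
  inB≢blank : ∀ {c : Colour} → c ≡ inB → c ≢ blank
  inB≢blank refl ()

  -- Per vertex: 2 steps for placing and examining it, and 3 for the walks that can visit it
  -- (once on the cycles that are kept apart, once on a cycle that runs into an old one, and
  -- once on the last walk).
  price : List (Fin n) → List (Fin n) → ℕ
  price r′ r = 3 * length r′ + 2 * length r

  -- The vertices of `r′` still hold their credit for walks. Colouring a vertex leaves it in `r′`; a
  -- walk that gets beyond its first vertex ends with `r′` cut down to `r`.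
  record Frontier (r′ r : List (Fin n)) : Set where
    field
      closed : Closed r′
      unique : Unique r′
      below  : ∀ {u} → u ∈ˡ r → u ∈ˡ r′

  -- The left side is the allowance; the right side is the fuel left plus what the walk has spent,
  -- since a move lengthens `T` by one and a swap archives `T` and opens a trail of length one. In
  -- `finishing`, two of the three allowances for `land` have been written off: one against the kept
  -- cycles, one against the trail that closed on an old cycle.
  data Progress (m : ℕ) (col : Fin n → Colour) (h : Fin n) (T land r : List (Fin n)) : Set where
    exploring : ∀ {es} → Fresh col h es T → (∀ {u} → u ∈ˡ concat es → u ∈ˡ land) →
      price r r + 3 * length land + 1 ≤ m + (length (concat es) + length T) → Progress m col h T land r
    finishing : (∀ {T′} → h ∈ˡ T′ → ¬ Tour col T′) →
      price r r + length land + 1 ≤ m + length T → Progress m col h T land r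

  data Valid (m : ℕ) : Phase → Set where
    idle  : ∀ {col r r′} → Pending col r → Independent col → Acyclic col → Frontier r′ r →
      price r′ r ≤ m → Valid m (idle col r)
    start : ∀ {col h p r r′} → Pending col r → Independent col → CyclesThrough col h → col h ≡ inB →
      (∃ λ y → y ∈ˡ r × h ~ y) ⊎ Closed r → Frontier r′ (h ∷ r) →
      price r′ r + 1 ≤ m → Valid m (walking col h h p r)
    roam  : ∀ {col h w p r T land} → Pending col r → Independent col → CyclesThrough col w →
      Closed r → Closed land → Trail col h w p T → (∀ {u} → u ∈ˡ T → u ∈ˡ land) →
      Progress m col h T land r → Valid m (walking col h w p r)

  -- The kept cycles and the trail are duplicate-free lists within `land`, so spending never exceeds
  -- the allowance, and one unit remains for the step that ends the walk.
  slack : ∀ {m col h w p T land r} → Trail col h w p T → (∀ {u} → u ∈ˡ T → u ∈ˡ land) →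
    Progress m col h T land r → price r r + 1 ≤ m
  slack {m} {T = T} {land} {r} tr T⊆ (finishing _ le) = +-cancelʳ-≤ (length land) _ _
    (≤-trans (≤-reflexive (lemma (price r r) (length land)))
      (≤-trans le (+-monoʳ-≤ m (unique-⊆⇒length≤ (Trail.distinct tr) T⊆))))
    where
    lemma : ∀ p l → p + 1 + l ≡ p + l + 1
    lemma = solve-∀
  slack {m} {T = T} {land} {r} tr T⊆ (exploring {es} fr V⊆ le) =
      ≤-trans (m≤m+n _ (length land)) (+-cancelʳ-≤ (length land + length land) _ _
    (≤-trans (≤-reflexive (lemma (price r r) (length land)))
      (≤-trans le
        (+-monoʳ-≤ m (+-mono-≤ (unique-⊆⇒length≤ (Fresh.once fr) V⊆) (unique-⊆⇒length≤ (Trail.distinct tr) T⊆))))))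
    where
    lemma : ∀ p l → p + 1 + l + (l + l) ≡ p + 3 * l + 1
    lemma = solve-∀

  -- No walk leaves the difference of two closed sets, so its size bounds the walks that start in it.
  module _ {r′ r : List (Fin n)} (F : Frontier r′ r) (closed-r : Closed r) (unique-r : Unique r) where
    open Frontier F

    difference : List (Fin n)
    difference = filter (λ u → ¬? (_∈?_ _≟ᶠ_ u r)) r′

    difference⁺ : ∀ {u} → u ∈ˡ r′ → u ∉ˡ r → u ∈ˡ difference
    difference⁺ = ∈-filter⁺ _

    difference⁻ : ∀ {u} → u ∈ˡ difference → u ∈ˡ r′ × u ∉ˡ r
    difference⁻ = ∈-filter⁻ (λ u → ¬? (_∈?_ _≟ᶠ_ u r))

    difference-closed : Closed difference
    difference-closed y∈ y~z with difference⁻ y∈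
    ... | y∈r′ , y∉r = difference⁺ (closed y∈r′ y~z) λ z∈r → y∉r (closed-r z∈r (~-sym y~z))

    difference-length : length difference + length r ≤ length r′
    difference-length = ≤-trans (≤-reflexive (sym (length-++ difference)))
      (unique-⊆⇒length≤ (unique-++⁺ (unique-filter⁺ _ unique) unique-r λ (u∈ , u∈r) → proj₂ (difference⁻ u∈) u∈r) sub)
      where
      sub : ∀ {x} → x ∈ˡ difference ++ r → x ∈ˡ r′
      sub x∈ with ∈-++⁻ difference x∈
      ... | inj₁ x∈d = proj₁ (difference⁻ x∈d)
      ... | inj₂ x∈r = below x∈r

  module _ (no-K₄ : K₄-free) where

    roam-step : ∀ {m col h w p r T land s} → Pending col r → Independent col → CyclesThrough col w →
      Closed r → Closed land → Trail col h w p T → (∀ {u} → u ∈ˡ T → u ∈ˡ land) →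
      Progress (suc m) col h T land r → walking col h w p r ⟶ s → Valid m s
    roam-step {m} {col} {w = w} {r = r} P ind thr cl cl′ tr T⊆ pr (lift none) =
      idle (paint-pending w P (inB≢blank (Trail.inB-T tr (Trail.w∈T tr))) λ ())
        (paintA-independent ind none) (paintA-acyclic thr)
        record { closed = cl ; unique = distinct P ; below = id }
            (≤-pred (subst (_≤ suc m) (+-comm (price r r) 1) (slack tr T⊆ pr)))
    roam-step {m} {col} {w = w} {r = r} P ind thr cl cl′ tr T⊆ pr (leaf one) =
      idle P ind (through⇒acyclic thr one)
        record { closed = cl ; unique = distinct P ; below = id }
            (≤-pred (subst (_≤ suc m) (+-comm (price r r) 1) (slack tr T⊆ pr)))
    roam-step {m} {col} {h} {w} {r = r} {T} {land} P ind thr cl cl′ tr T⊆ pr (move t b₁≢p b₁≢h) =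
      roam P ind (through-b₁ t thr) cl cl′ (trail-move tr t b₁≢p b₁≢h)
        (λ { (here refl) → cl′ (T⊆ (Trail.w∈T tr)) (w~b₁ t) ; (there u∈) → T⊆ u∈ }) (go pr)
      where
      lemma : ∀ m v t → suc m + (v + t) ≡ m + (v + suc t)
      lemma = solve-∀
      go : Progress (suc m) col h T land r → Progress m col h (b₁ t ∷ T) land r
      go (exploring {es} fr V⊆ le) = exploring (fresh-move tr fr t b₁≢p b₁≢h) V⊆
        (≤-trans le (≤-reflexive (lemma m (length (concat es)) (length T))))
      go (finishing none le) = finishing none (≤-trans le (≤-reflexive (lemma m 0 (length T))))
    roam-step {m} {col} {h} {w} {r = r} {T} {land} P ind thr cl cl′ tr T⊆ pr (close t b₁≢p b₁≡h) =
      roam (paint-pending (a t) (paint-pending w P (inB≢blank (Trail.inB-T tr (Trail.w∈T tr))) λ ()) a≢blank λ ())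
        (swap-independent t ind) (paintB-through (paintA-acyclic thr)) cl cl′
        (trail-start (paint-≡ (paint col w inA) (a t) inB)) (λ { (here refl) → a∈land }) (go pr)
      where
      a∈land : a t ∈ˡ land
      a∈land = cl′ (T⊆ (Trail.w∈T tr)) (w~a t)
      a≢blank : paint col w inA (a t) ≢ blank
      a≢blank = inA≢blank (paint-id col w (a t) (a-inA t))
      lemma : ∀ m v t → suc m + (v + t) ≡ m + (t + v + 1)
      lemma = solve-∀
      lemma′ : ∀ p l → p + l + 1 + (l + l) ≡ p + 3 * l + 1
      lemma′ = solve-∀
      go : Progress (suc m) col h T land r → Progress m (swapped col w (a t)) (a t) [ a t ] land r
      go (finishing none le) = contradiction (λ {u} → trail-close tr t b₁≢p b₁≡h {u}) (none (Trail.h∈T tr))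
      go (exploring {es} fr V⊆ le) with Fresh.side fr
      ... | avoids T∉ = exploring (close-avoiding tr fr t b₁≢p b₁≡h T∉) sub
            (≤-trans le
              (≤-reflexive (trans (lemma m (length (concat es)) (length T))
                (cong (λ k → m + (k + 1)) (sym (length-++ T))))))
        where
        sub : ∀ {u} → u ∈ˡ concat (T ∷ es) → u ∈ˡ land
        sub u∈ with ∈-++⁻ T u∈
        ... | inj₁ u∈T = T⊆ u∈T
        ... | inj₂ u∈V = V⊆ u∈V
      ... | within C∈ T⊆C = finishing (close-within tr fr t b₁≢p b₁≡h C∈ T⊆C no-K₄)
            (subst (price r r + length land + 1 ≤_) (+-comm 1 m) (+-cancelʳ-≤ (length land + length land) _ _
              (≤-trans (≤-reflexive (lemma′ (price r r) (length land)))
                (≤-trans le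
                  (+-monoʳ-≤ (suc m) (+-mono-≤ (unique-⊆⇒length≤ (Fresh.once fr) V⊆)
                    (unique-⊆⇒length≤ (Trail.distinct tr) T⊆)))))))

    -- An uncoloured neighbour of `h` would contradict `Turn`. Hence `h` is a root and `r` is
    -- closed, which makes the rest of `r′` closed as well: the walk is confined to it.
    start-turn : ∀ {m col h p r r′ s} → Pending col r → Independent col → CyclesThrough col h → col h ≡ inB →
      (∃ λ y → y ∈ˡ r × h ~ y) ⊎ Closed r → Frontier r′ (h ∷ r) → price r′ r + 1 ≤ suc m →
      Turn col h → walking col h h p r ⟶ s → Valid m s
    start-turn P ind thr h-inB (inj₁ (y , y∈ , h~y)) F le t st = contradiction (blanks P y∈) (not-blank t h~y)
    start-turn {m} {col} {h} {p} {r} {r′} P ind thr h-inB (inj₂ closed-r) F le t st =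
      roam-step P ind thr closed-r (difference-closed F′ closed-r (distinct P)) (trail-start h-inB)
        (λ { (here refl) → difference⁺ F′ closed-r (distinct P) (Frontier.below F (here refl)) λ h∈r →
          inB≢blank h-inB (blanks P h∈r) })
        (exploring fresh-start (λ ()) budget) st
      where
      F′ : Frontier r′ r
      F′ = record { closed = Frontier.closed F ; unique = Frontier.unique F ; below = Frontier.below F ∘ there }
      land = difference F′ closed-r (distinct P)
      lemma : ∀ l r → 3 * r + 2 * r + 3 * l ≡ 3 * (l + r) + 2 * r
      lemma = solve-∀
      budget : price r r + 3 * length land + 1 ≤ suc m + 1
      budget = +-monoˡ-≤ 1 (≤-trans (≤-reflexive (lemma (length land) (length r)))
        (≤-trans (+-monoˡ-≤ (2 * length r) (*-monoʳ-≤ 3 (difference-length F′ closed-r (distinct P))))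
          (≤-trans (m≤m+n _ 1) le)))

    preserve : ∀ {m s s′} → Valid (suc m) s → s ⟶ s′ → Valid m s′
    preserve {m} (idle {col} {x ∷ r} {r′} P ind acyc F le) begin with ordered P | distinct P
    ... | reason ∷ ord | u@(_ ∷ u′) =
      start record
          { blanks   = λ {y} y∈ → trans (paint-≢ col inB λ { refl → Unique[x∷xs]⇒x∉xs u y∈ }) (blanks P (there y∈))
          ; covers   = covers′
          ; distinct = u′
          ; ordered  = ord }
        (paintB-independent ind) (paintB-through acyc) (paint-≡ col x inB) reason F
        (≤-pred (≤-trans (≤-reflexive (lemma (3 * length r′) (length r))) le))
      where
      lemma : ∀ p r → suc (p + 2 * r + 1) ≡ p + 2 * suc r
      lemma = solve-∀
      covers′ : ∀ v → v ∈ˡ r ⊎ paint col x inB v ≢ blank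
      covers′ v with v ≟ᶠ x | covers P v
      ... | yes _   | _                 = inj₂ λ ()
      ... | no v≢x  | inj₁ (here v≡x)   = contradiction v≡x v≢x
      ... | no _    | inj₁ (there v∈)   = inj₁ v∈
      ... | no _    | inj₂ ≢blank       = inj₂ ≢blank
    preserve {m} (start {col} {h} {r = r} {r′} P ind thr h-inB reason F le) (lift none) =
      idle (paint-pending h P (inB≢blank h-inB) λ ()) (paintA-independent ind none) (paintA-acyclic thr)
        record { closed = Frontier.closed F ; unique = Frontier.unique F ; below = Frontier.below F ∘ there }
        (≤-pred (subst (_≤ suc m) (+-comm (price r′ r) 1) le))
    preserve {m} (start {r = r} {r′} P ind thr h-inB reason F le) (leaf one) =
      idle P ind (through⇒acyclic thr one)
        record { closed = Frontier.closed F ; unique = Frontier.unique F ; below = Frontier.below F ∘ there }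
        (≤-pred (subst (_≤ suc m) (+-comm (price r′ r) 1) le))
    preserve (start P ind thr h-inB reason F le) st@(move t _ _)  = start-turn P ind thr h-inB reason F le t st
    preserve (start P ind thr h-inB reason F le) st@(close t _ _) = start-turn P ind thr h-inB reason F le t st
    preserve (roam P ind thr cl cl′ tr T⊆ pr) st = roam-step P ind thr cl cl′ tr T⊆ pr st

  -- Together with `idle-positive`: fuel can run out only when nothing is left to colour.
  walking-positive : ∀ {m col h w p r} → Valid m (walking col h w p r) → 1 ≤ m
  walking-positive (start {r = r} {r′} _ _ _ _ _ _ le) = ≤-trans (m≤n+m 1 (price r′ r)) le
  walking-positive (roam {r = r} _ _ _ _ _ tr T⊆ pr)   = ≤-trans (m≤n+m 1 (price r r)) (slack tr T⊆ pr)

  idle-positive : ∀ {m col x r} → Valid m (idle col (x ∷ r)) → 1 ≤ m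
  idle-positive (idle {r′ = r′} _ _ _ _ le) = ≤-trans (≤-trans (s≤s z≤n) (m≤n+m _ (3 * length r′))) le

  valid-start : ∀ {q} → (∀ v → v ∈ˡ q) → Unique q → SearchOrder q →
    Valid (price q q) (idle (λ _ → blank) q)
  valid-start {q} total unique ordered = idle
    record { blanks = λ _ → refl ; covers = λ u → inj₁ (total u) ; distinct = unique ; ordered = ordered }
    (λ ()) no-cycle record { closed = λ _ _ → total _ ; unique = unique ; below = id } ≤-refl
    where
    no-cycle : Acyclic (λ _ → blank)
    no-cycle _ (() ∷ _)

-- The program that carries out the process

slot-unique : ∀ {X : Set} {x : X} xs i j → Unique xs → slot xs i ≡ just x → slot xs j ≡ just x → i ≡ j
slot-unique (y ∷ xs) zero    zero    u       eq   eq′  = refl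
slot-unique (y ∷ xs) zero    (suc j) u       refl eq′  = contradiction (slot⇒∈ xs j eq′) (Unique[x∷xs]⇒x∉xs u)
slot-unique (y ∷ xs) (suc i) zero    u       eq   refl = contradiction (slot⇒∈ xs i eq) (Unique[x∷xs]⇒x∉xs u)
slot-unique (y ∷ xs) (suc i) (suc j) (_ ∷ u) eq   eq′  = cong suc (slot-unique xs i j u eq eq′)

isA isB : Colour → ℕ
isA inA = 1
isA _   = 0
isB inB = 1
isB _   = 0

isA≢0 : ∀ {c} → isA c ≢ 0 → c ≡ inA
isA≢0 {blank} ≢0 = contradiction refl ≢0
isA≢0 {inA}   ≢0 = refl
isA≢0 {inB}   ≢0 = contradiction refl ≢0

isB≢0 : ∀ {c} → isB c ≢ 0 → c ≡ inB
isB≢0 {blank} ≢0 = contradiction refl ≢0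
isB≢0 {inA}   ≢0 = contradiction refl ≢0
isB≢0 {inB}   ≢0 = refl

isB≤1 : ∀ c → isB c ≤ 1
isB≤1 blank = z≤n
isB≤1 inA   = z≤n
isB≤1 inB   = ≤-refl

data OneATwoB : Colour → Colour → Colour → Set where
  abb : OneATwoB inA inB inB
  bab : OneATwoB inB inA inB
  bba : OneATwoB inB inB inA

twoB : ∀ {c d} → 2 ≤ isB c + isB d → c ≡ inB × d ≡ inB
twoB {blank} {d} le = contradiction (≤-trans le (isB≤1 d)) λ { (s≤s ()) }
twoB {inA}   {d} le = contradiction (≤-trans le (isB≤1 d)) λ { (s≤s ()) }
twoB {inB}   {d} (s≤s le) = refl , isB≢0 (λ eq → contradiction (subst (1 ≤_) eq le) λ ())

oneATwoB : ∀ c d e → isA c + isA d + isA e ≢ 0 → 2 ≤ isB c + isB d + isB e → OneATwoB c d e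
oneATwoB inA d e ≢0 le with twoB {d} {e} le
... | refl , refl = abb
oneATwoB blank d e ≢0 le with twoB {d} {e} le
... | refl , refl = contradiction refl ≢0
oneATwoB inB inA e ≢0 (s≤s le) with isB≢0 {e} (λ eq → contradiction (subst (1 ≤_) eq le) λ ())
... | refl = bab
oneATwoB inB inB e ≢0 le with isA≢0 {e} ≢0
... | refl = bba
oneATwoB inB blank e ≢0 (s≤s le) with isA≢0 {e} ≢0
... | refl = contradiction le λ ()

different : ℕ → ℕ → Expr
different r r′ = (reg r ⊖ reg r′) ⊕ (reg r′ ⊖ reg r)

-- The third neighbour is taken untested, as `pick` is run only where some neighbour qualifies.
pick : (ℕ → Expr) → ℕ → Cmd
pick f r = test f rX then r ≔ reg rX else (test f rY then r ≔ reg rY else r ≔ reg rZ)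

-- As x ≤ 1, the difference x ∸ (1 ∸ d) is nonzero exactly when x = 1 and d ≠ 0.
isAExpr isNextExpr : ℕ → Expr
isAExpr r    = aA at reg r
isNextExpr r = aB at reg r ⊖ (lit 1 ⊖ different r rP)

dye : ℕ → Colour → Cmd
dye r c = aA at reg r ← lit (isA c) ⨾ aB at reg r ← lit (isB c)

countA countB walkGuard : Expr
countA    = aA at reg rX ⊕ aA at reg rY ⊕ aA at reg rZ
countB    = aB at reg rX ⊕ aB at reg rY ⊕ aB at reg rZ
walkGuard = reg rI ⊕ reg rM

begins moves closes turns lifts walks walkBody walkLoop : Cmd
begins   = rI ≔ reg rI ⊖ lit 1 ⨾ rW ≔ aQ at reg rI ⨾ rH ≔ reg rW ⨾ rP ≔ reg rW ⨾ rM ≔ lit 1 ⨾ dye rW inB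
moves    = rP ≔ reg rW ⨾ rW ≔ reg rT
closes   = rH ≔ reg rA ⨾ rP ≔ reg rW ⨾ rW ≔ reg rA ⨾ dye rP inA ⨾ dye rW inB
turns    = pick isAExpr rA ⨾ pick isNextExpr rT ⨾ (test different rT rH then moves else closes)
lifts    = rM ≔ lit 0 ⨾ dye rW inA
walks    = fetch ⨾ (test countA then (test countB ⊖ lit 1 then turns else rM ≔ lit 0) else lifts)
walkBody = test reg rM then walks else begins
walkLoop = while walkGuard loop walkBody

module Walking {n : ℕ} {G : Graph (Fin n)} (L : AdjacencyLists G) (subcubic : Subcubic G) where
  open Lists L subcubic
  open Walks G
  open Phases L subcubic

  colour : (Fin n → Colour) → Maybe (Fin n) → Colour
  colour col = maybe′ col blank

  colour-just : ∀ {col} s {c} → colour col s ≡ c → c ≢ blank → ∃ λ v → s ≡ just v × col v ≡ c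
  colour-just nothing  eq c≢ = contradiction (sym eq) c≢
  colour-just (just v) eq c≢ = v , refl , eq

  record Holds (σ : State) (col : Fin n → Colour) (q : List (Fin n)) : Set where
    field
      memory : Memory σ
      cellsA : ∀ s → arrs σ aA (address s) ≡ isA (colour col s)
      cellsB : ∀ s → arrs σ aB (address s) ≡ isB (colour col s)
      stored : Stored (arrs σ aQ) q
      tail   : regs σ rI ≡ length q

  data Represents (σ : State) : Phase → Set where
    idle    : ∀ {col q} → Holds σ col q → regs σ rM ≡ 0 → Represents σ (idle col q)
    walking : ∀ {col h w p q} → Holds σ col q → regs σ rM ≡ 1 →
      regs σ rH ≡ toℕ h → regs σ rW ≡ toℕ w → regs σ rP ≡ toℕ p → Represents σ (walking col h w p q)

  rename : ∀ {σ col q ρ} → Holds σ col q → ρ rN ≡ regs σ rN → ρ rI ≡ regs σ rI → Holds ⟨ ρ , arrs σ ⟩ col q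
  rename H eqN eqI = record
    { memory = remember memory eqN refl refl
    ; cellsA = cellsA ; cellsB = cellsB ; stored = stored ; tail = trans eqI tail }
    where open Holds H

  -- Painting never writes to cell `n`, so a missing neighbour keeps reading as uncoloured and adds
  -- nothing to either count.
  paint-cells : ∀ (f : ℕ → ℕ) (g : Colour → ℕ) col v c → (∀ s → f (address s) ≡ g (colour col s)) →
    ∀ s → (f [ toℕ v ↦ g c ]) (address s) ≡ g (colour (paint col v c) s)
  paint-cells f g col v c cells nothing = trans (update-≢ f (g c) (<⇒≢ (toℕ<n v) ∘ sym)) (cells nothing)
  paint-cells f g col v c cells (just u) with u ≟ᶠ v
  ... | yes refl = update-≡ f (toℕ v) (g c)
  ... | no u≢v   = trans (update-≢ f (g c) (u≢v ∘ toℕ-injective)) (cells (just u))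

  module _ {W : ℕ} (n<W : n < W) (1<W : 1 < W) where

    vertex<W : ∀ {m} (v : Fin n) → m ≡ toℕ v → m < W
    vertex<W v refl = <-trans (toℕ<n v) n<W

    isA<W : ∀ c → isA c < W
    isA<W blank = <⇒≤ 1<W
    isA<W inA   = 1<W
    isA<W inB   = <⇒≤ 1<W

    isB<W : ∀ c → isB c < W
    isB<W blank = <⇒≤ 1<W
    isB<W inA   = <⇒≤ 1<W
    isB<W inB   = 1<W

    dye-correct : ∀ {σ col q} r v c → Holds σ col q → regs σ r ≡ toℕ v →
      ⟪ W ⟫ (dye r c) σ (λ σ′ → regs σ′ ≡ regs σ × Holds σ′ (paint col v c) q)
    dye-correct {σ} {col} {q} r v c H r≡ =
      store⨾ (vertex<W v r≡) (isA<W c) (store (vertex<W v r≡) (isB<W c) (refl , record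
        { memory = remember memory refl refl refl
        ; cellsA =
          λ s → trans (cong (λ i → (arrs σ aA [ i ↦ isA c ]) (address s)) r≡)
              (paint-cells (arrs σ aA) isA col v c cellsA s)
        ; cellsB =
          λ s → trans (cong (λ i → (arrs σ aB [ i ↦ isB c ]) (address s)) r≡)
              (paint-cells (arrs σ aB) isB col v c cellsB s)
        ; stored = stored ; tail = tail }))
      where open Holds H

    begins-correct : ∀ {σ col x q} → Holds σ col (x ∷ q) → length (x ∷ q) ≤ n →
      ⟪ W ⟫ begins σ (λ σ′ → ∃ λ s → idle col (x ∷ q) ⟶ s × Represents σ′ s)
    begins-correct {σ} {col} {x} {q} H fits = go stored
      where
      open Holds H
      tail′ : regs σ rI ∸ 1 ≡ length q
      tail′ = cong (_∸ 1) tail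
      go : Stored (arrs σ aQ) (x ∷ q) → ⟪ W ⟫ begins σ (λ σ′ → ∃ λ s → idle col (x ∷ q) ⟶ s × Represents σ′ s)
      go (cell ∷ st) =
        assign⨾ (subst (_< W) (sym tail′) (<-trans fits n<W)) (
        assign⨾ (vertex<W x x≡) (
        assign⨾ (vertex<W x x≡) (
        assign⨾ (vertex<W x x≡) (
        assign⨾ 1<W (
        weaken (dye-correct rW x inB record
          { memory = remember memory refl refl refl
          ; cellsA = cellsA ; cellsB = cellsB ; stored = st ; tail = tail′ } x≡)
          λ { {⟨ _ , _ ⟩} (refl , H′) → _ , begin , walking H′ refl x≡ x≡ x≡ })))))
        where
        x≡ : arrs σ aQ (regs σ rI ∸ 1) ≡ toℕ x
        x≡ = trans (cong (arrs σ aQ) tail′) cell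

    module _ {col : Fin n → Colour} {h w p : Fin n} {q : List (Fin n)} where

      private
        s : ℕ → Maybe (Fin n)
        s = slot (neighbours w)

        adjacent : ∀ k {x} → s k ≡ just x → w ~ x
        adjacent k eq = Equivalence.to (correct w _) (slot⇒∈ (neighbours w) k eq)

        slots : ∀ {x} → w ~ x → s 0 ≡ just x ⊎ s 1 ≡ just x ⊎ s 2 ≡ just x
        slots w~x = ∈⇒slot (length-neighbours w) (Equivalence.from (correct w _) w~x)

        After : State → Set
        After σ′ = ∃ λ s′ → walking col h w p q ⟶ s′ × Represents σ′ s′

      record Ready (σ : State) : Set where
        field
          holds : Holds σ col q
          M≡    : regs σ rM ≡ 1
          H≡    : regs σ rH ≡ toℕ h
          W≡    : regs σ rW ≡ toℕ w
          P≡    : regs σ rP ≡ toℕ p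
          X≡    : regs σ rX ≡ address (s 0)
          Y≡    : regs σ rY ≡ address (s 1)
          Z≡    : regs σ rZ ≡ address (s 2)

      pick-correct : ∀ {σ} f r (P : Fin n → Set) {Q} → Ready σ →
        (∀ i s → regs σ i ≡ address s → eval σ (f i) ≢ 0 → ∃ λ x → s ≡ just x × P x) →
        (∀ i x → regs σ i ≡ toℕ x → eval σ (f i) ≡ 0 → ¬ P x) →
        (∃ λ x → w ~ x × P x) →
        (∀ {x} → w ~ x → P x → Q ⟨ regs σ [ r ↦ toℕ x ] , arrs σ ⟩) →
        ⟪ W ⟫ (pick f r) σ Q
      pick-correct {σ} f r P {Q} R sound complete (y , w~y , Py) k =
        branch (λ ≢0 → found rX 0 X≡ (sound rX (s 0) X≡ ≢0)) λ ≡0 →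
        branch (λ ≢0 → found rY 1 Y≡ (sound rY (s 1) Y≡ ≢0)) λ ≡0′ →
        found rZ 2 Z≡ (y , third ≡0 ≡0′ (slots w~y) , Py)
        where
        open Ready R
        found : ∀ i k → regs σ i ≡ address (s k) → (∃ λ x → s k ≡ just x × P x) → ⟪ W ⟫ (r ≔ reg i) σ Q
        found i j eq (x , sj≡ , Px) = assign (vertex<W x i≡)
          (subst (λ m → Q ⟨ regs σ [ r ↦ m ] , arrs σ ⟩) (sym i≡) (k (adjacent j sj≡) Px))
          where
          i≡ : regs σ i ≡ toℕ x
          i≡ = trans eq (cong address sj≡)
        third : eval σ (f rX) ≡ 0 → eval σ (f rY) ≡ 0 → s 0 ≡ just y ⊎ s 1 ≡ just y ⊎ s 2 ≡ just y → s 2 ≡ just y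
        third ≡0 _   (inj₁ eq)        = contradiction Py (complete rX y (trans X≡ (cong address eq)) ≡0)
        third _  ≡0′ (inj₂ (inj₁ eq)) = contradiction Py (complete rY y (trans Y≡ (cong address eq)) ≡0′)
        third _  _   (inj₂ (inj₂ eq)) = eq

      pickA-correct : ∀ {σ} {Q} → Ready σ → (t : Turn col w) →
        Q ⟨ regs σ [ rA ↦ toℕ (a t) ] , arrs σ ⟩ → ⟪ W ⟫ (pick isAExpr rA) σ Q
      pickA-correct {σ} {Q} R t k = pick-correct isAExpr rA (λ x → col x ≡ inA) R
        (λ i s i≡ ≢0 → colour-just s (isA≢0 (λ ≡0 → ≢0 (trans (cong (arrs σ aA) i≡) (trans (cellsA s) ≡0)))) λ ())
        (λ i x i≡ ≡0 x-inA →
          contradiction (trans (sym ≡0) (trans (cong (arrs σ aA) i≡) (trans (cellsA (just x)) (cong isA x-inA))))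
              λ ())
        (a t , w~a t , a-inA t)
        (λ {x} w~x x-inA → subst (λ v → Q ⟨ regs σ [ rA ↦ toℕ v ] , arrs σ ⟩) (sym (onlyA t w~x x-inA)) k)
        where open Holds (Ready.holds R)

      -- The machine finds some B-neighbour other than `p`; the turn is reoriented so that this one
      -- becomes `b₁`.
      aim : (t : Turn col w) → ∀ {x} → w ~ x → col x ≡ inB → Σ (Turn col w) λ t′ → a t′ ≡ a t × b₁ t′ ≡ x
      aim t w~x x-inB with onlyB t w~x x-inB
      ... | inj₁ refl = t , refl , refl
      ... | inj₂ refl = record
        { w~a = w~a t ; w~b₁ = w~b₂ t ; w~b₂ = w~b₁ t ; a-inA = a-inA t ; b₁-inB = b₂-inB t ; b₂-inB = b₁-inB t
        ; b₁≢b₂ = b₁≢b₂ t ∘ sym ; only = only′ ∘ only t } , refl , refl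
        where
        only′ : ∀ {y} → y ≡ a t ⊎ y ≡ b₁ t ⊎ y ≡ b₂ t → y ≡ a t ⊎ y ≡ b₂ t ⊎ y ≡ b₁ t
        only′ (inj₁ eq)        = inj₁ eq
        only′ (inj₂ (inj₁ eq)) = inj₂ (inj₂ eq)
        only′ (inj₂ (inj₂ eq)) = inj₂ (inj₁ eq)

      different≡0 : ∀ m k → (m ∸ k) + (k ∸ m) ≡ 0 → m ≡ k
      different≡0 m k eq = ≤-antisym (m∸n≡0⇒m≤n (m+n≡0⇒m≡0 (m ∸ k) eq)) (m∸n≡0⇒m≤n (m+n≡0⇒n≡0 (m ∸ k) eq))

      different-refl : ∀ m → (m ∸ m) + (m ∸ m) ≡ 0
      different-refl m = cong₂ _+_ (n∸n≡0 m) (n∸n≡0 m)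

      pickNext-correct : ∀ {σ} {Q} → Ready σ → (t : Turn col w) →
        ((t′ : Turn col w) → a t′ ≡ a t → b₁ t′ ≢ p → Q ⟨ regs σ [ rT ↦ toℕ (b₁ t′) ] , arrs σ ⟩) →
        ⟪ W ⟫ (pick isNextExpr rT) σ Q
      pickNext-correct {σ} {Q} R t k = pick-correct isNextExpr rT (λ x → col x ≡ inB × x ≢ p) R
        sound complete candidate conclude
        where
        open Ready R
        open Holds holds
        gap : ℕ → ℕ
        gap i = (i ∸ regs σ rP) + (regs σ rP ∸ i)
        sound : ∀ i s → regs σ i ≡ address s → eval σ (isNextExpr i) ≢ 0 → ∃ λ x → s ≡ just x × col x ≡ inB × x ≢ p
        sound i s i≡ ≢0 with isB (colour col s) in eq | trans (cong (arrs σ aB) i≡) (cellsB s)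
        ... | zero  | cell =
            contradiction (trans (cong (_∸ (1 ∸ gap (regs σ i))) cell) (0∸n≡0 (1 ∸ gap (regs σ i)))) ≢0
        ... | suc m | cell with colour-just s (isB≢0 (λ ≡0 → contradiction (trans (sym eq) ≡0) λ ())) (λ ())
        ...   | x , s≡ , x-inB = x , s≡ , x-inB , λ x≡p → ≢0 (trans
                (cong₂ (λ c j → c ∸ (1 ∸ gap j)) (trans cell (sym eq))
                  (trans i≡ (trans (cong address s≡) (trans (cong toℕ x≡p) (sym P≡)))))
                (trans (cong (λ d → isB (colour col s) ∸ (1 ∸ d)) (different-refl (regs σ rP)))
                  (m≤n⇒m∸n≡0 (isB≤1 (colour col s)))))
        complete : ∀ i x → regs σ i ≡ toℕ x → eval σ (isNextExpr i) ≡ 0 → ¬ (col x ≡ inB × x ≢ p)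
        complete i x i≡ ≡0 (x-inB , x≢p)
          with gap (regs σ i) in eq | trans (cong (arrs σ aB) i≡) (trans (cellsB (just x)) (cong isB x-inB))
        ... | zero  | _    = x≢p (toℕ-injective (trans (sym i≡) (trans (different≡0 (regs σ i) (regs σ rP) eq) P≡)))
        ... | suc d | cell =
            contradiction (trans (sym ≡0) (trans (cong (arrs σ aB (regs σ i) ∸_) (0∸n≡0 d)) cell)) λ ()
        candidate : ∃ λ x → w ~ x × col x ≡ inB × x ≢ p
        candidate with b₁ t ≟ᶠ p
        ... | no b₁≢p  = b₁ t , w~b₁ t , b₁-inB t , b₁≢p
        ... | yes b₁≡p = b₂ t , w~b₂ t , b₂-inB t , λ b₂≡p → b₁≢b₂ t (trans b₁≡p (sym b₂≡p))
        conclude : ∀ {x} → w ~ x → col x ≡ inB × x ≢ p → Q ⟨ regs σ [ rT ↦ toℕ x ] , arrs σ ⟩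
        conclude w~x (x-inB , x≢p) with aim t w~x x-inB
        ... | t′ , a≡ , refl = k t′ a≡ x≢p

      turns-correct : ∀ {σ} → Ready σ → Turn col w → ⟪ W ⟫ turns σ After
      turns-correct {σ} R t =
        pickA-correct {Q = _≡ σ₁} R t refl then λ { refl →
        pickNext-correct {Q = Chosen} R₁ t (λ t′ a≡ b₁≢p → t′ , a≡ , b₁≢p , refl) then λ { (t′ , a≡ , b₁≢p , refl) →
        branch (moving t′ b₁≢p) (closing t′ a≡ b₁≢p) } }
        where
        open Ready R
        open Holds holds
        σ₁ = ⟨ regs σ [ rA ↦ toℕ (a t) ] , arrs σ ⟩
        R₁ : Ready σ₁
        R₁ = record
          { holds = rename holds refl refl
          ; M≡ = M≡ ; H≡ = H≡ ; W≡ = W≡ ; P≡ = P≡ ; X≡ = X≡ ; Y≡ = Y≡ ; Z≡ = Z≡ }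
        Chosen : State → Set
        Chosen σ′ = Σ (Turn col w) λ t′ → a t′ ≡ a t × b₁ t′ ≢ p × ⟨ regs σ₁ [ rT ↦ toℕ (b₁ t′) ] , arrs σ ⟩ ≡ σ′
        module _ (t′ : Turn col w) where
          σ₂ : State
          σ₂ = ⟨ regs σ₁ [ rT ↦ toℕ (b₁ t′) ] , arrs σ ⟩
          σ₃ : State
          σ₃ = ⟨ ((regs σ₂ [ rH ↦ toℕ (a t) ]) [ rP ↦ regs σ rW ]) [ rW ↦ toℕ (a t) ] , arrs σ ⟩
          moving : b₁ t′ ≢ p → eval σ₂ (different rT rH) ≢ 0 → ⟪ W ⟫ moves σ₂ After
          moving b₁≢p ≢0 =
            assign⨾ (vertex<W w W≡) (
            assign (vertex<W (b₁ t′) refl)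
              (_ , move t′ b₁≢p (λ b₁≡h →
                ≢0 (trans (cong (λ k → (toℕ (b₁ t′) ∸ k) + (k ∸ toℕ (b₁ t′))) (trans H≡ (cong toℕ (sym b₁≡h))))
                      (different-refl (toℕ (b₁ t′))))) ,
               walking (rename holds refl refl) M≡ H≡ refl W≡))
          closing : a t′ ≡ a t → b₁ t′ ≢ p → eval σ₂ (different rT rH) ≡ 0 → ⟪ W ⟫ closes σ₂ After
          closing a≡ b₁≢p ≡0 =
            assign⨾ (vertex<W (a t) refl) (
            assign⨾ (vertex<W w W≡) (
            assign⨾ (vertex<W (a t) refl) (
            dye-correct {σ = σ₃} rP w inA (rename holds refl refl) W≡ then λ { {⟨ _ , _ ⟩} (refl , H₁) →
            weaken (dye-correct rW (a t) inB H₁ refl) λ { {⟨ _ , α ⟩} (refl , H₂) →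
              _ , close t′ b₁≢p (toℕ-injective (trans (different≡0 (toℕ (b₁ t′)) (regs σ rH) ≡0) H≡)) ,
              -- The registers hold `a t`, whereas the transition is made with the reoriented turn
              -- `t′`.
              subst (λ c → Represents ⟨ regs σ₃ , α ⟩ (walking (swapped col w c) c c w q)) (sym a≡)
                  (walking H₂ M≡ refl refl W≡) } })))

      walks-correct : ∀ {σ} → Represents σ (walking col h w p q) → ⟪ W ⟫ walks σ After
      walks-correct {σ} (walking holds M≡ H≡ W≡ P≡) =
        fetch-correct n<W w {Q = _≡ σ₁} memory W≡ refl then λ { refl →
        branch (λ A≢0 → branch (λ B≢0 → turns-correct R (turn A≢0 B≢0)) stop) lifting }
        where
        open Holds holds
        c : ℕ → Colour
        c k = colour col (s k)
        σ₁ = ⟨ ((regs σ [ rX ↦ address (s 0) ]) [ rY ↦ address (s 1) ]) [ rZ ↦ address (s 2) ] , arrs σ ⟩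
        R : Ready σ₁
        R = record
          { holds = rename holds refl refl
          ; M≡ = M≡ ; H≡ = H≡ ; W≡ = W≡ ; P≡ = P≡ ; X≡ = refl ; Y≡ = refl ; Z≡ = refl }
        countA≡ : eval σ₁ countA ≡ isA (c 0) + isA (c 1) + isA (c 2)
        countA≡ = cong₂ _+_ (cong₂ _+_ (cellsA (s 0)) (cellsA (s 1))) (cellsA (s 2))
        countB≡ : eval σ₁ countB ≡ isB (c 0) + isB (c 1) + isB (c 2)
        countB≡ = cong₂ _+_ (cong₂ _+_ (cellsB (s 0)) (cellsB (s 1))) (cellsB (s 2))

        lifting : eval σ₁ countA ≡ 0 → ⟪ W ⟫ lifts σ₁ After
        lifting ≡0 = assign⨾ (<⇒≤ 1<W) (
          weaken (dye-correct rW w inA (rename holds refl refl) W≡) λ { {⟨ _ , _ ⟩} (refl , H′) →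
            _ , lift none , idle H′ refl })
          where
          sum≡0 : isA (c 0) + isA (c 1) + isA (c 2) ≡ 0
          sum≡0 = trans (sym countA≡) ≡0
          colourless : ∀ k {x} → isA (c k) ≡ 0 → s k ≡ just x → col x ≢ inA
          colourless k ≡0 eq x-inA =
              contradiction (trans (sym ≡0) (trans (cong (isA ∘ colour col) eq) (cong isA x-inA))) λ ()
          none : ∀ {x} → w ~ x → col x ≢ inA
          none w~x with slots w~x
          ... | inj₁ eq        = colourless 0 (m+n≡0⇒m≡0 (isA (c 0)) (m+n≡0⇒m≡0 _ sum≡0)) eq
          ... | inj₂ (inj₁ eq) = colourless 1 (m+n≡0⇒n≡0 (isA (c 0)) (m+n≡0⇒m≡0 _ sum≡0)) eq
          ... | inj₂ (inj₂ eq) = colourless 2 (m+n≡0⇒n≡0 (isA (c 0) + isA (c 1)) sum≡0) eq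

        stop : eval σ₁ countB ∸ 1 ≡ 0 → ⟪ W ⟫ (rM ≔ lit 0) σ₁ After
        stop ≡0 = assign (<⇒≤ 1<W) (_ , leaf one , idle (rename holds refl refl) refl)
          where
          sum≤1 : isB (c 0) + isB (c 1) + isB (c 2) ≤ 1
          sum≤1 = subst (_≤ 1) countB≡ (m∸n≡0⇒m≤n ≡0)
          counted : ∀ k {x} → s k ≡ just x → col x ≡ inB → 1 ≤ isB (c k)
          counted k eq x-inB = ≤-reflexive (sym (trans (cong (isB ∘ colour col) eq) (cong isB x-inB)))
          1+1≰1 : ∀ {i j} → 1 ≤ i → 1 ≤ j → ¬ i + j ≤ 1
          1+1≰1 1≤i 1≤j le = contradiction (≤-trans (+-mono-≤ 1≤i 1≤j) le) λ { (s≤s ()) }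
          ≤01 : isB (c 0) + isB (c 1) ≤ 1
          ≤01 = ≤-trans (m≤m+n _ _) sum≤1
          ≤02 : isB (c 0) + isB (c 2) ≤ 1
          ≤02 = ≤-trans (+-monoˡ-≤ (isB (c 2)) (m≤m+n (isB (c 0)) (isB (c 1)))) sum≤1
          ≤12 : isB (c 1) + isB (c 2) ≤ 1
          ≤12 = ≤-trans (+-monoˡ-≤ (isB (c 2)) (m≤n+m (isB (c 1)) (isB (c 0)))) sum≤1
          one : ∀ {x y} → w ~ x → w ~ y → col x ≡ inB → col y ≡ inB → x ≡ y
          one w~x w~y x-inB y-inB with slots w~x | slots w~y
          ... | inj₁ ex        | inj₁ ey        = just-injective (trans (sym ex) ey)
          ... | inj₂ (inj₁ ex) | inj₂ (inj₁ ey) = just-injective (trans (sym ex) ey)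
          ... | inj₂ (inj₂ ex) | inj₂ (inj₂ ey) = just-injective (trans (sym ex) ey)
          ... | inj₁ ex        | inj₂ (inj₁ ey) = contradiction ≤01 (1+1≰1 (counted 0 ex x-inB) (counted 1 ey y-inB))
          ... | inj₁ ex        | inj₂ (inj₂ ey) = contradiction ≤02 (1+1≰1 (counted 0 ex x-inB) (counted 2 ey y-inB))
          ... | inj₂ (inj₁ ex) | inj₁ ey        = contradiction ≤01 (1+1≰1 (counted 0 ey y-inB) (counted 1 ex x-inB))
          ... | inj₂ (inj₁ ex) | inj₂ (inj₂ ey) = contradiction ≤12 (1+1≰1 (counted 1 ex x-inB) (counted 2 ey y-inB))
          ... | inj₂ (inj₂ ex) | inj₁ ey        = contradiction ≤02 (1+1≰1 (counted 0 ey y-inB) (counted 2 ex x-inB))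
          ... | inj₂ (inj₂ ex) | inj₂ (inj₁ ey) = contradiction ≤12 (1+1≰1 (counted 1 ey y-inB) (counted 2 ex x-inB))

        turn : eval σ₁ countA ≢ 0 → eval σ₁ countB ∸ 1 ≢ 0 → Turn col w
        turn A≢0 B≢0 = build (oneATwoB (c 0) (c 1) (c 2) (λ ≡0 → A≢0 (trans countA≡ ≡0))
          (≰⇒> λ le → B≢0 (m≤n⇒m∸n≡0 (subst (_≤ 1) (sym countB≡) le)))) refl refl refl
          where
          apart : ∀ i j {x y} → i ≢ j → s i ≡ just x → s j ≡ just y → x ≢ y
          apart i j i≢j ei ej refl = i≢j (slot-unique (neighbours w) i j (unique w) ei ej)
          value : ∀ {k l x y} → s k ≡ just x → s l ≡ just y → k ≡ l → y ≡ x
          value ek el refl = just-injective (trans (sym el) ek)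
          build : ∀ {c₀ c₁ c₂} → OneATwoB c₀ c₁ c₂ → c 0 ≡ c₀ → c 1 ≡ c₁ → c 2 ≡ c₂ → Turn col w
          build abb e₀ e₁ e₂
            with colour-just (s 0) e₀ (λ ()) | colour-just (s 1) e₁ (λ ()) | colour-just (s 2) e₂ (λ ())
          ... | x , ex , cx | y , ey , cy | z , ez , cz = record
            { w~a = adjacent 0 ex ; w~b₁ = adjacent 1 ey ; w~b₂ = adjacent 2 ez
            ; a-inA = cx ; b₁-inB = cy ; b₂-inB = cz
            ; b₁≢b₂ = apart 1 2 (λ ()) ey ez ; only = λ w~v → only′ (slots w~v) }
            where
            only′ : ∀ {v} → s 0 ≡ just v ⊎ s 1 ≡ just v ⊎ s 2 ≡ just v → v ≡ x ⊎ v ≡ y ⊎ v ≡ z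
            only′ (inj₁ e)        = inj₁ (value {0} ex e refl)
            only′ (inj₂ (inj₁ e)) = inj₂ (inj₁ (value {1} ey e refl))
            only′ (inj₂ (inj₂ e)) = inj₂ (inj₂ (value {2} ez e refl))
          build bab e₀ e₁ e₂
            with colour-just (s 0) e₀ (λ ()) | colour-just (s 1) e₁ (λ ()) | colour-just (s 2) e₂ (λ ())
          ... | x , ex , cx | y , ey , cy | z , ez , cz = record
            { w~a = adjacent 1 ey ; w~b₁ = adjacent 0 ex ; w~b₂ = adjacent 2 ez
            ; a-inA = cy ; b₁-inB = cx ; b₂-inB = cz
            ; b₁≢b₂ = apart 0 2 (λ ()) ex ez ; only = λ w~v → only′ (slots w~v) }
            where
            only′ : ∀ {v} → s 0 ≡ just v ⊎ s 1 ≡ just v ⊎ s 2 ≡ just v → v ≡ y ⊎ v ≡ x ⊎ v ≡ z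
            only′ (inj₁ e)        = inj₂ (inj₁ (value {0} ex e refl))
            only′ (inj₂ (inj₁ e)) = inj₁ (value {1} ey e refl)
            only′ (inj₂ (inj₂ e)) = inj₂ (inj₂ (value {2} ez e refl))
          build bba e₀ e₁ e₂
            with colour-just (s 0) e₀ (λ ()) | colour-just (s 1) e₁ (λ ()) | colour-just (s 2) e₂ (λ ())
          ... | x , ex , cx | y , ey , cy | z , ez , cz = record
            { w~a = adjacent 2 ez ; w~b₁ = adjacent 0 ex ; w~b₂ = adjacent 1 ey
            ; a-inA = cz ; b₁-inB = cx ; b₂-inB = cy
            ; b₁≢b₂ = apart 0 1 (λ ()) ex ey ; only = λ w~v → only′ (slots w~v) }
            where
            only′ : ∀ {v} → s 0 ≡ just v ⊎ s 1 ≡ just v ⊎ s 2 ≡ just v → v ≡ z ⊎ v ≡ x ⊎ v ≡ y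
            only′ (inj₁ e)        = inj₂ (inj₁ (value {0} ex e refl))
            only′ (inj₂ (inj₁ e)) = inj₂ (inj₂ (value {1} ey e refl))
            only′ (inj₂ (inj₂ e)) = inj₁ (value {2} ez e refl)

-- Four-cliques as components, and colourings as decompositions

module _ {n : ℕ} where

  ∈-tabulate : ∀ {f : Fin n → Bool} {v} → f v ≡ true → v ∈ Vec.tabulate f
  ∈-tabulate {f} {v} eq = lookup⇒[]= v _ (trans (lookup∘tabulate f v) eq)

  tabulate-∈ : ∀ {f : Fin n → Bool} {v} → v ∈ Vec.tabulate f → f v ≡ true
  tabulate-∈ {f} {v} v∈ = trans (sym (lookup∘tabulate f v)) ([]=⇒lookup v∈)

  member-≡ : ∀ {S : Subset n} {x y : ∃ (_∈ S)} → proj₁ x ≡ proj₁ y → x ≡ y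
  member-≡ {x = v , p} {.v , q} refl = cong (v ,_) ([]=-irrelevant p q)

  module _ (G : Graph (Fin n)) (subcubic : Subcubic G) (corner : Fin 4 → Fin n)
           (complete : ∀ {i j} → i ≢ j → Adj G (corner i) (corner j)) where

    private
      corner-injective : ∀ {i j} → corner i ≡ corner j → i ≡ j
      corner-injective {i} {j} eq with i ≟ᶠ j
      ... | yes i≡j = i≡j
      ... | no  i≢j = contradiction (complete i≢j) (Graph.irrefl G eq)

      corners : List (Fin n)
      corners = List.tabulate corner

      -- A fifth vertex next to corner i would leave corner i with four neighbours.
      saturated : ∀ {i x} → Adj G (corner i) x → x ∈ˡ corners
      saturated {i} {x} adj with _∈?_ _≟ᶠ_ x corners
      ... | yes x∈ = x∈
      ... | no x∉ = contradiction
        (≤-trans (unique-⊆⇒length≤ (¬Any⇒All¬ corners x∉ ∷ unique-tabulate⁺ corner-injective) sub)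
          (s≤s (subcubic (corner i))))
        λ { (s≤s (s≤s (s≤s (s≤s ())))) }
        where
        near : ∀ {y} → Adj G (corner i) y → y ∈ˡ filter (Graph.adj? G (corner i)) (allFin n)
        near = ∈-filter⁺ (Graph.adj? G (corner i)) (∈-allFin _)
        sub : ∀ {y} → y ∈ˡ x ∷ corners → y ∈ˡ corner i ∷ filter (Graph.adj? G (corner i)) (allFin n)
        sub (here refl) = there (near adj)
        sub (there y∈) with ∈-tabulate⁻ {f = corner} y∈
        ... | j , refl with i ≟ᶠ j
        ...   | yes refl = here refl
        ...   | no i≢j   = there (near (complete i≢j))

      C : Subset n
      C = Vec.tabulate λ v → does (_∈?_ _≟ᶠ_ v corners)

      ∈C : ∀ i → corner i ∈ C
      ∈C i = ∈-tabulate (dec-true (_∈?_ _≟ᶠ_ (corner i) corners) (∈-tabulate⁺ {f = corner} i))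

      find : ∀ {v} → v ∈ C → ∃ λ i → v ≡ corner i
      find {v} v∈ =
          ∈-tabulate⁻ {f = corner} (witness (_∈?_ _≟ᶠ_ v corners) (tabulate-∈ {λ v → does (_∈?_ _≟ᶠ_ v corners)} v∈))
        where
        witness : ∀ {P : Set} (d : Dec P) → does d ≡ true → P
        witness (yes p) _ = p

      ∈C′ : ∀ {v} → v ∈ˡ corners → v ∈ C
      ∈C′ v∈ with ∈-tabulate⁻ {f = corner} v∈
      ... | i , refl = ∈C i

    -- By `saturated` no edge leaves the four corners, so a clique on four vertices in a subcubic
    -- graph is a whole component.
    K₄-component : ∃[ C ] (IsComponent G C × (G ⟦ C ⟧) ≅ K 4)
    K₄-component = C , ((corner zero , ∈C zero) , λ u v u∈ → mk⇔ (connected u∈) (λ path → stays path u∈)) , record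
      { bijection = mk↔ₛ′ (λ (_ , v∈) → proj₁ (find v∈)) (λ i → corner i , ∈C i)
                          (λ i → corner-injective (sym (proj₂ (find (∈C i)))))
                          (λ (_ , v∈) → member-≡ (sym (proj₂ (find v∈))))
      ; preserves = λ (u , u∈) (v , v∈) → mk⇔
          (λ adj eq → Graph.irrefl G (trans (proj₂ (find u∈)) (trans (cong corner eq) (sym (proj₂ (find v∈))))) adj)
          (λ ≢ → subst₂ (Adj G) (sym (proj₂ (find u∈))) (sym (proj₂ (find v∈))) (complete ≢))
      }
      where
      connected : ∀ {u v} → u ∈ C → v ∈ C → Star (Adj G) u v
      connected u∈ v∈ with find u∈ | find v∈
      ... | i , refl | j , refl with i ≟ᶠ j
      ...   | yes refl = ε
      ...   | no i≢j   = complete i≢j ◅ ε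
      stays : ∀ {u v} → Star (Adj G) u v → u ∈ C → v ∈ C
      stays ε u∈ = u∈
      stays (adj ◅ path) u∈ with find u∈
      ... | i , refl = stays path (∈C′ (saturated {i} adj))

  no-K₄ : ∀ {G : Graph (Fin n)} → Subcubic G → ¬ (∃[ C ] (IsComponent G C × (G ⟦ C ⟧) ≅ K 4)) →
    Walks.K₄-free G
  no-K₄ {G} subcubic none {b} {c} {d} {e} bc bd be cd ce de = none (K₄-component G subcubic corner complete)
    where
    corner : Fin 4 → Fin n
    corner = Vec.lookup (b Vec.∷ c Vec.∷ d Vec.∷ e Vec.∷ Vec.[])
    complete : ∀ {i j} → i ≢ j → Adj G (corner i) (corner j)
    complete {zero}                {zero}                ≢ = contradiction refl ≢
    complete {zero}                {suc zero}            _ = bc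
    complete {zero}                {suc (suc zero)}      _ = bd
    complete {zero}                {suc (suc (suc zero))} _ = be
    complete {suc zero}            {zero}                _ = Graph.sym G bc
    complete {suc zero}            {suc zero}            ≢ = contradiction refl ≢
    complete {suc zero}            {suc (suc zero)}      _ = cd
    complete {suc zero}            {suc (suc (suc zero))} _ = ce
    complete {suc (suc zero)}      {zero}                _ = Graph.sym G bd
    complete {suc (suc zero)}      {suc zero}            _ = Graph.sym G cd
    complete {suc (suc zero)}      {suc (suc zero)}      ≢ = contradiction refl ≢
    complete {suc (suc zero)}      {suc (suc (suc zero))} _ = de
    complete {suc (suc (suc zero))} {zero}                _ = Graph.sym G be
    complete {suc (suc (suc zero))} {suc zero}            _ = Graph.sym G ce
    complete {suc (suc (suc zero))} {suc (suc zero)}      _ = Graph.sym G de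
    complete {suc (suc (suc zero))} {suc (suc (suc zero))} ≢ = contradiction refl ≢

  module _ {G : Graph (Fin n)} {S : Subset n} where

    cycle-⟦⟧ : ∀ {v us} → IsCycle (G ⟦ S ⟧) v us → IsCycle G (proj₁ v) (map proj₁ us)
    cycle-⟦⟧ {v} {us} (le , unique , links) =
      ≤-trans le (≤-reflexive (sym (length-map proj₁ us))) ,
      unique-map⁺ member-≡ unique ,
      subst (λ ws → Linked (Adj G) (proj₁ v ∷ ws)) (map-++ proj₁ us [ v ]) (linked-map⁺ links)

  toBool : Colour → Bool × Bool
  toBool blank = false , false
  toBool inA   = true , false
  toBool inB   = false , true

  partA partB : (Fin n → Colour) → Subset n
  partA col = Vec.tabulate (proj₁ ∘ toBool ∘ col)
  partB col = Vec.tabulate (proj₂ ∘ toBool ∘ col)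

  module _ (col : Fin n → Colour) where

    ∈partA : ∀ {v} → v ∈ partA col → col v ≡ inA
    ∈partA {v} v∈ with col v | tabulate-∈ {proj₁ ∘ toBool ∘ col} v∈
    ... | inA | _ = refl

    ∈partB : ∀ {v} → v ∈ partB col → col v ≡ inB
    ∈partB {v} v∈ with col v | tabulate-∈ {proj₂ ∘ toBool ∘ col} v∈
    ... | inB | _ = refl

    partA-output : ∀ v → isA (col v) ≡ (if Vec.lookup (partA col) v then 1 else 0)
    partA-output v rewrite lookup∘tabulate (proj₁ ∘ toBool ∘ col) v with col v
    ... | blank = refl
    ... | inA   = refl
    ... | inB   = refl

  module _ {G : Graph (Fin n)} (col : Fin n → Colour) where
    open Walks G

    near-bipartite : Independent col → Acyclic col → (∀ v → col v ≢ blank) → IsNearBipartite G (partA col) (partB col)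
    near-bipartite ind acyc total = record
      { covers      = ⊆-antisym ⊆⊤ (λ {v} _ → x∈p∪q⁺ (side v (total v)))
      ; disjoint    = ⊆-antisym (λ v∈ → let v∈A , v∈B = x∈p∩q⁻ (partA col) (partB col) v∈
                                        in contradiction (∈partB col v∈B) (A≢B (∈partA col v∈A))) ⊥⊆
      ; independent = λ u v u∈ v∈ → ind (∈partA col u∈) (∈partA col v∈)
      ; forest      =
        λ v us cyc →
            acyc (cycle-⟦⟧ {G = G} cyc) (all-map⁺ {xs = v ∷ us} (All.tabulate λ {x} _ → ∈partB col (proj₂ x)))
      }
      where
      side : ∀ v → col v ≢ blank → v ∈ partA col ⊎ v ∈ partB col
      side v v≢ with col v in eq
      ... | blank = contradiction refl v≢
      ... | inA   = inj₁ (∈-tabulate (cong (proj₁ ∘ toBool) eq))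
      ... | inB   = inj₂ (∈-tabulate (cong (proj₂ ∘ toBool) eq))

-- The whole program and its linear bound

initialise program : Cmd
initialise = aV at reg rN ← lit 1
program    = initialise ⨾ search ⨾ walkLoop

searchTime walkTime : ℕ
searchTime = suc (cost searchGuard + bound searchBody)
walkTime   = suc (cost walkGuard + bound walkBody)

opaque
  -- The search loop makes at most `n + n` passes (roots tried and entries expanded) and the walk
  -- loop at most `5 * n`, the `3 + 2` of `price`; each loop adds one failing test. The summand 2
  -- makes both 1 and `n` fit into a word. Being opaque, this large closed numeral is not unfolded
  -- outside the block.
  factor : ℕ
  factor = 2 + (bound initialise + 2 * searchTime + 5 * walkTime)

  factor≥2 : 2 ≤ factor
  factor≥2 = m≤m+n 2 (bound initialise + 2 * searchTime + 5 * walkTime)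

  time≤ : ∀ n → bound initialise + (suc (n + n) * searchTime + suc (5 * n) * walkTime) ≤ factor * suc n
  time≤ n = sum≤ (bound initialise) searchTime walkTime
    where
    arithmetic : ∀ k s w n → k + (suc (n + n) * s + suc (5 * n) * w) + (2 * suc n + k * n + s + 4 * w) ≡
      (2 + (k + 2 * s + 5 * w)) * suc n
    arithmetic = solve-∀
    sum≤ : ∀ k s w → k + (suc (n + n) * s + suc (5 * n) * w) ≤ (2 + (k + 2 * s + 5 * w)) * suc n
    sum≤ k s w = ≤-trans (m≤m+n _ _) (≤-reflexive (arithmetic k s w n))

module _ {n : ℕ} {G : Graph (Fin n)} (L : AdjacencyLists G) (subcubic : Subcubic G)
         (none : ¬ (∃[ C ] (IsComponent G C × (G ⟦ C ⟧) ≅ K 4))) where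
  open Search L subcubic
  open Walks G
  open Phases L subcubic
  open Walking L subcubic

  private
    W : ℕ
    W = factor * suc n

    1<W : 1 < W
    1<W = ≤-trans factor≥2 (≤-trans (≤-reflexive (sym (*-identityʳ factor))) (*-monoʳ-≤ factor (s≤s z≤n)))

    n<W : n < W
    n<W = ≤-trans (≤-reflexive (sym (*-identityˡ (suc n)))) (*-monoˡ-≤ (suc n) (<⇒≤ factor≥2))

  Decomposes : State → Set
  Decomposes σ = Σ (Subset n) λ A → Σ (Subset n) λ B → IsNearBipartite G A B × Outputs σ A

  WalkInvariant : ℕ → State → Set
  WalkInvariant m σ = ∃ λ s → Valid m s × Represents σ s

  walk-step : ∀ m σ → WalkInvariant m σ →
    (eval σ walkGuard ≡ 0 × Decomposes σ) ⊎
    (eval σ walkGuard ≢ 0 × ∃ λ m′ → m ≡ suc m′ × ⟪ W ⟫ walkBody σ (WalkInvariant m′))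
  walk-step m σ (idle col [] , idle P ind acyc F le , idle H M≡) = inj₁
    ( cong₂ _+_ (Holds.tail H) M≡
    , partA col , partB col , near-bipartite col ind acyc total
    , λ v → trans (Holds.cellsA H (just v)) (partA-output col v))
    where
    total : ∀ v → col v ≢ blank
    total v with Pending.covers P v
    ... | inj₂ ≢blank = ≢blank
  walk-step zero σ (idle col (x ∷ q) , V , _) = contradiction (idle-positive V) λ ()
  walk-step zero σ (walking col h w p q , V , _) = contradiction (walking-positive V) λ ()
  walk-step (suc m) σ (idle col (x ∷ q) , V@(idle P _ _ _ _) , idle H M≡) = inj₂
    ( (λ ≡0 → contradiction (trans (sym (Holds.tail H)) (m+n≡0⇒m≡0 (regs σ rI) ≡0)) λ ())
    , m , refl , branch (λ ≢0 → contradiction M≡ ≢0) λ _ →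
      weaken (begins-correct n<W 1<W H (length≤n (Pending.distinct P)))
        λ (s , st , R) → s , preserve (no-K₄ {G = G} subcubic none) V st , R)
  walk-step (suc m) σ (walking col h w p q , V , R@(walking H M≡ _ _ _)) = inj₂
    ( (λ ≡0 → contradiction (trans (sym M≡) (m+n≡0⇒n≡0 (regs σ rI) ≡0)) λ ())
    , m , refl , branch (λ _ →
        weaken (walks-correct n<W 1<W R) λ (s , st , R′) → s , preserve (no-K₄ {G = G} subcubic none) V st , R′)
      λ ≡0 → contradiction (trans (sym M≡) ≡0) λ ())

  walk-correct : ∀ {σ} → Completed σ → Ends W (suc (5 * n) * walkTime) walkLoop σ Decomposes
  walk-correct {σ} done = hasten (iterate WalkInvariant walk-step (price order order)
      (idle (λ _ → blank) order , valid-start total (Queue.distinct queue) (Queue.ordered queue) ,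
        idle holds (Queue.idle queue)))
    where
    open Completed done
    colour-blank : ∀ s → colour (λ _ → blank) s ≡ blank
    colour-blank (just _) = refl
    colour-blank nothing  = refl
    holds : Holds σ (λ _ → blank) order
    holds = record
      { memory = Queue.memory queue
      ; cellsA = λ s → trans (cong (λ f → f (address s)) (Queue.blankA queue)) (sym (cong isA (colour-blank s)))
      ; cellsB = λ s → trans (cong (λ f → f (address s)) (Queue.blankB queue)) (sym (cong isB (colour-blank s)))
      ; stored = Queue.stored queue
      ; tail   = Queue.tail queue
      }
    lemma : ∀ k → 3 * k + 2 * k ≡ 5 * k
    lemma = solve-∀
    price≤ : price order order ≤ 5 * n
    price≤ = ≤-trans (≤-reflexive (lemma (length order))) (*-monoʳ-≤ 5 (length≤n (Queue.distinct queue)))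
    hasten : Ends W (suc (price order order) * walkTime) walkLoop σ Decomposes →
      Ends W (suc (5 * n) * walkTime) walkLoop σ Decomposes
    hasten (t , σ′ , run , le , d) = t , σ′ , run , ≤-trans le (*-monoˡ-≤ walkTime (s≤s price≤)) , d

  program-correct : FindsNearBipartite (factor * suc n) (factor * suc n) program L
  program-correct = found (initialise-correct n<W 1<W then (λ I → search-correct n<W 1<W I then walk-correct))
    where
    found : Ends W (bound initialise + (suc (n + n) * searchTime + suc (5 * n) * walkTime)) program (input L)
        Decomposes →
      FindsNearBipartite W W program L
    found (t , σ , run , le , A , B , near , out) = t , σ , run , ≤-trans le (time≤ n) , A , B , near , out

theorem6 : ∃[ p ] ∃[ c ] (∀ n (G : Graph (Fin n)) → Subcubic G →
    ¬ (∃[ C ] (IsComponent G C × (G ⟦ C ⟧) ≅ K 4)) →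
    (L : AdjacencyLists G) →
    FindsNearBipartite (c * suc n) (c * suc n) p L)
theorem6 = program , factor , λ n G subcubic none L → program-correct L subcubic none
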